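{- Let $k\ge 2$ and let $G$ be a minimally $k$-connected graph with $n$ vertices and $m$ edges. Then $$|V_k|=\frac{m-n+c_F+|E_k|}{k-1}.$$ In particular, $$|V_k|\ge\left\lceil\frac{m-n+k}{k-1}\right\rceil.$$
   Context: All graphs are finite, simple and undirected. A $k$-separator is a set of $k\ge 0$ vertices whose deletion leaves a disconnected graph. A graph is $k$-connected if it has more than $k$ vertices and contains no $(k-1)$-separator. A $k$-connected graph $G$ is minimally $k$-connected if $G-e$ is not $k$-connected for every edge $e$. For a graph $G$: $V_k$ is the set of vertices of degree exactly $k$; $E_k$ is the set of edges of $G$ with both end vertices in $V_k$; $F:=G-V_k$ is the graph obtained by deleting $V_k$; and $c_F$ is the number of connected components of $F$. -}

module Defs where

open import Level using (0ℓ)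
open import Data.Nat using (ℕ; suc; _<_; _≟_)
open import Data.Fin using (Fin)
import Data.Fin as Fin
import Data.Fin.Properties as Fin
open import Data.Fin.Subset using (Subset; _∈_; _∉_; _⊆_; _─_; ∣_∣)
open import Data.Fin.Subset.Properties using (_∈?_; x∈p∧x∉q⇒x∈p─q)
open import Data.List using (List; []; _∷_; length; filter; allFin; cartesianProduct; deduplicate)
import Data.List.Membership.Propositional as List
open import Data.List.Membership.Propositional.Properties using (∈-allFin)
open import Data.List.Relation.Unary.Any using (here; there)
open import Data.Vec using (tabulate)
open import Data.Product using (_×_; _,_; proj₁; proj₂)
open import Data.Sum using (_⊎_; inj₁; inj₂; [_,_]′)
open import Function using (_∘_; id)
open import Relation.Binary using (Rel; Decidable; Symmetric)
open import Relation.Binary.Construct.Closure.ReflexiveTransitive using (Star; ε; _◅_; _◅◅_)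
open import Relation.Binary.PropositionalEquality using (_≡_; refl)
open import Relation.Nullary using (¬_; Dec; does; ¬?; _×-dec_; _⊎-dec_; map′)

-- The vertices form an arbitrary subset of Fin N, rather than all of Fin N, so
-- that vertex-deleted subgraphs are again graphs on the same names.
record Graph (N : ℕ) : Set₁ where
  field
    V       : Subset N
    Adj     : Rel (Fin N) 0ℓ
    adj?    : Decidable Adj
    adj-sym : Symmetric Adj
    irrefl  : ∀ {x} → ¬ Adj x x
    adj⇒∈V  : ∀ {x y} → Adj x y → x ∈ V

open Graph public

module _ {N : ℕ} where

  SameEdge : (x y u v : Fin N) → Set
  SameEdge x y u v = (u ≡ x × v ≡ y) ⊎ (u ≡ y × v ≡ x)

  sameEdge? : ∀ x y u v → Dec (SameEdge x y u v)
  sameEdge? x y u v =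
    (u Fin.≟ x ×-dec v Fin.≟ y) ⊎-dec (u Fin.≟ y ×-dec v Fin.≟ x)

  deleteVertices : Graph N → Subset N → Graph N
  deleteVertices G S = record
    { V       = V G ─ S
    ; Adj     = λ x y → Adj G x y × x ∉ S × y ∉ S
    ; adj?    = λ x y → adj? G x y ×-dec ¬? (x ∈? S) ×-dec ¬? (y ∈? S)
    ; adj-sym = λ (a , x∉S , y∉S) → adj-sym G a , y∉S , x∉S
    ; irrefl  = λ (a , _) → irrefl G a
    ; adj⇒∈V  = λ (a , x∉S , _) → x∈p∧x∉q⇒x∈p─q (adj⇒∈V G a) x∉S
    }

  deleteEdge : Graph N → Fin N → Fin N → Graph N
  deleteEdge G x y = record
    { V       = V G
    ; Adj     = λ u v → Adj G u v × ¬ SameEdge x y u v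
    ; adj?    = λ u v → adj? G u v ×-dec ¬? (sameEdge? x y u v)
    ; adj-sym = λ (a , ne) → adj-sym G a , ne ∘ flip-edge
    ; irrefl  = λ (a , _) → irrefl G a
    ; adj⇒∈V  = λ (a , _) → adj⇒∈V G a
    }
    where
    flip-edge : ∀ {u v} → SameEdge x y v u → SameEdge x y u v
    flip-edge (inj₁ (p , q)) = inj₂ (q , p)
    flip-edge (inj₂ (p , q)) = inj₁ (q , p)

  order : Graph N → ℕ
  order G = ∣ V G ∣

  -- Each undirected edge is listed once, as the pair with its smaller end first.
  edges : Graph N → List (Fin N × Fin N)
  edges G = filter (λ (x , y) → x Fin.<? y ×-dec adj? G x y)
                   (cartesianProduct (allFin N) (allFin N))

  size : Graph N → ℕ
  size G = length (edges G)

  degree : Graph N → Fin N → ℕ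
  degree G x = length (filter (adj? G x) (allFin N))

  verticesOfDegree : ℕ → Graph N → Subset N
  verticesOfDegree k G = tabulate λ v → does (v ∈? V G ×-dec degree G v ≟ k)

  edgesWithin : Graph N → Subset N → List (Fin N × Fin N)
  edgesWithin G S = filter (λ (x , y) → x ∈? S ×-dec y ∈? S) (edges G)

  Reachable : Graph N → Rel (Fin N) 0ℓ
  Reachable G = Star (Adj G)

  -- The empty graph counts as connected.  This convention is immaterial below:
  -- a (k-1)-separator is only considered in a graph with more than k vertices.
  Connected : Graph N → Set
  Connected G = ∀ {x y} → x ∈ V G → y ∈ V G → Reachable G x y

  IsSeparator : ℕ → Graph N → Subset N → Set
  IsSeparator k G S = S ⊆ V G × ∣ S ∣ ≡ k × ¬ Connected (deleteVertices G S)

  -- Writing k = suc j avoids truncated subtraction: no separator has size -1.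
  KConnected : ℕ → Graph N → Set
  KConnected k G =
    k < order G × (∀ {j} → k ≡ suc j → ∀ S → ¬ IsSeparator j G S)

  MinimallyKConnected : ℕ → Graph N → Set
  MinimallyKConnected k G =
    KConnected k G × (∀ x y → Adj G x y → ¬ KConnected k (deleteEdge G x y))

-- Reachability is decided by Warshall's algorithm: `Via zs x y` says that some
-- walk from x to y has all its inner vertices in zs.
module Warshall {N : ℕ} (G : Graph N) where

  Via : List (Fin N) → Rel (Fin N) 0ℓ
  Via []       x y = x ≡ y ⊎ Adj G x y
  Via (z ∷ zs) x y = Via zs x y ⊎ (Via zs x z × Via zs z y)

  via? : ∀ zs → Decidable (Via zs)
  via? []       x y = x Fin.≟ y ⊎-dec adj? G x y
  via? (z ∷ zs) x y = via? zs x y ⊎-dec (via? zs x z ×-dec via? zs z y)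

  via⇒reachable : ∀ zs {x y} → Via zs x y → Reachable G x y
  via⇒reachable []       (inj₁ refl)    = ε
  via⇒reachable []       (inj₂ a)       = a ◅ ε
  via⇒reachable (z ∷ zs) (inj₁ p)       = via⇒reachable zs p
  via⇒reachable (z ∷ zs) (inj₂ (p , q)) = via⇒reachable zs p ◅◅ via⇒reachable zs q

  via-base : ∀ zs {x y} → Via [] x y → Via zs x y
  via-base []       p = p
  via-base (z ∷ zs) p = inj₁ (via-base zs p)

  via-trans : ∀ zs {x y z} → z List.∈ zs → Via zs x z → Via zs z y → Via zs x y
  via-trans (w ∷ zs) (here refl) p q = inj₂ ([ id , proj₁ ]′ p , [ id , proj₂ ]′ q)
  via-trans (w ∷ zs) (there i) (inj₁ p)        (inj₁ q)        = inj₁ (via-trans zs i p q)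
  via-trans (w ∷ zs) (there i) (inj₁ p)        (inj₂ (q , q′)) = inj₂ (via-trans zs i p q , q′)
  via-trans (w ∷ zs) (there i) (inj₂ (p , p′)) (inj₁ q)        = inj₂ (p , via-trans zs i p′ q)
  via-trans (w ∷ zs) (there i) (inj₂ (p , _))  (inj₂ (_ , q′)) = inj₂ (p , q′)

  reachable⇒via : ∀ {x y} → Reachable G x y → Via (allFin N) x y
  reachable⇒via ε        = via-base (allFin N) (inj₁ refl)
  reachable⇒via (a ◅ as) =
    via-trans (allFin N) (∈-allFin _) (via-base (allFin N) (inj₂ a)) (reachable⇒via as)

module _ {N : ℕ} where

  reachable? : (G : Graph N) → Decidable (Reachable G)
  reachable? G x y = map′ (via⇒reachable (allFin N)) reachable⇒via (via? (allFin N) x y)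
    where open Warshall G

  -- Deduplicating up to reachability keeps exactly one vertex per component.
  componentCount : Graph N → ℕ
  componentCount G = length (deduplicate (reachable? G) (filter (_∈? V G) (allFin N)))

-- Every edge xy of a minimally k-connected graph has a separation (A, S, B):
-- |S| = k - 1, x ∈ A, y ∈ B, and xy is the only edge between A and B.  If xyz is a
-- path and y has degree > k, uncrossing separations (A, S, B) of xy and (C, T, D)
-- of yz gives A ∩ D = ∅ and |D| < |B|.  The far sides thus shrink along paths in F, so F is
-- a forest, and counting edges and degrees yields the formula.
--
-- The bound amounts to c_F + |Eₖ| ≥ k.  A cycle may contain just one vertex of
-- degree k, so such a vertex can have several neighbours in one component of F.
-- But if v has degree k and every edge of F has a separation whose middle part
-- misses v, orient the edges of F towards v: by A ∩ D = ∅ out-degrees are at most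
-- one, and the neighbours of v are sinks, so each component of F contains at most
-- one of them and v has k - c_F neighbours in Vₖ.  To find v take a separation
-- (D, T, C) of an edge of F with |D| least.  If 2|D| ≥ k, uncrossing makes the
-- separations of all edges of F miss D, and any v ∈ D ∩ Vₖ will do.  Otherwise D is
-- so small that two vertices of D ∩ Vₖ see k edges of Eₖ, while a single one has
-- its neighbours in F inside D, where they lie in different components because
-- only one edge of F has an end in D.
module Submission where

open import Defs
open import Data.Nat using (ℕ; zero; suc; _≤_; z≤n; s≤s)
open import Data.Fin.Subset using (∣_∣)
open import Data.List using (length)
open import Data.Product using (_×_; _,_)
open import Relation.Binary.PropositionalEquality

module GraphTheory where
  open import Data.Nat using (_+_; _*_; _<_; _≟_; _≤?_; _<?_)
  open import Data.Nat.Properties hiding (_≟_; _≤?_; _<?_)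
  open import Data.Nat.Induction using (<-wellFounded)
  open import Data.Nat.Solver using (module +-*-Solver)
  open import Induction.WellFounded using (Acc; acc)
  open import Data.Bool using (true; false; if_then_else_)
  open import Data.Fin using (Fin; zero; suc)
  import Data.Fin as Fin
  import Data.Fin.Properties as Fin
  open import Data.Fin.Subset using (Subset; _∈_; _∉_; _⊆_; _─_; _-_; ⁅_⁆; inside; outside)
  open import Data.Fin.Subset.Properties
    using (_∈?_; _⊆?_; anySubset?; drop-there; drop-∷-⊆; out⊆; in⊆in; ⊆-refl; p─q⊆p;
           x∈p∧x∉q⇒x∈p─q; x∈p∧x≢y⇒x∈p-y; x∈⁅x⁆)
  open import Data.Vec using ([]; _∷_; here; there; tabulate)
  open import Data.Vec.Properties using (lookup∘tabulate; []=⇒lookup; lookup⇒[]=)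
  open import Data.List as List using (List; []; _∷_; _++_; filter; allFin; cartesianProduct; deduplicate)
  open import Data.List.Properties using (filter-++; length-++)
  open import Data.List.Membership.Propositional.Properties using (∈-lookup; ∈-allFin; ∈-filter⁺)
  open import Data.List.Relation.Unary.All as All using (All; []; _∷_)
  import Data.List.Relation.Unary.All.Properties as All
  open import Data.List.Relation.Unary.Any as Any using (Any)
  import Data.List.Relation.Unary.Any.Properties as Any
  open import Data.List.Relation.Unary.AllPairs using (AllPairs; []; _∷_)
  import Data.List.Relation.Unary.AllPairs.Properties as AllPairs
  open import Data.Product using (proj₁; proj₂; ∃-syntax)
  open import Data.Sum using (_⊎_; inj₁; inj₂; [_,_]′)
  open import Data.Empty using (⊥; ⊥-elim)
  open import Function using (_∘_; id)
  open import Relation.Unary using (Pred; Decidable)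
  open import Relation.Nullary using (¬_; Dec; yes; no; does; ¬?; _×-dec_; _→-dec_)
  open import Relation.Nullary.Decidable using (dec-true; dec-false; from-yes; decidable-stable)
  open import Relation.Binary using (Rel; Symmetric; Transitive; tri<; tri≈; tri>)
  open import Relation.Binary.Construct.Closure.ReflexiveTransitive as Star using (Star; ε; _◅_; _◅◅_)
  import Algebra.Properties.CommutativeMonoid.Sum +-0-commutativeMonoid as Sum


  -- Finite sums

  𝟙 : ∀ {p} {P : Set p} → Dec P → ℕ
  𝟙 d = if does d then 1 else 0

  𝟙-yes : ∀ {p} {P : Set p} (d : Dec P) → P → 𝟙 d ≡ 1
  𝟙-yes d p = cong (if_then 1 else 0) (dec-true d p)

  𝟙-no : ∀ {p} {P : Set p} (d : Dec P) → ¬ P → 𝟙 d ≡ 0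
  𝟙-no d ¬p = cong (if_then 1 else 0) (dec-false d ¬p)

  𝟙-cong : ∀ {p q} {P : Set p} {Q : Set q} (d : Dec P) (e : Dec Q) →
           (P → Q) → (Q → P) → 𝟙 d ≡ 𝟙 e
  𝟙-cong (yes p) e f g = sym (𝟙-yes e (f p))
  𝟙-cong (no ¬p) e f g = sym (𝟙-no e (¬p ∘ g))

  𝟙≤1 : ∀ {p} {P : Set p} (d : Dec P) → 𝟙 d ≤ 1
  𝟙≤1 (yes _) = s≤s z≤n
  𝟙≤1 (no _)  = z≤n

  -- The library's sum unfolds on its length, which defeats unification; keep it opaque.
  opaque
    sum : ∀ {n} → (Fin n → ℕ) → ℕ
    sum = Sum.sum

    sum-[] : ∀ {f : Fin 0 → ℕ} → sum f ≡ 0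
    sum-[] = refl

    sum-∷ : ∀ {n} (f : Fin (suc n) → ℕ) → sum f ≡ f zero + sum (f ∘ suc)
    sum-∷ f = refl

    sum-cong : ∀ {n} {f g : Fin n → ℕ} → (∀ i → f i ≡ g i) → sum f ≡ sum g
    sum-cong = Sum.sum-cong-≗

    sum-+ : ∀ {n} (f g : Fin n → ℕ) → sum (λ i → f i + g i) ≡ sum f + sum g
    sum-+ = Sum.∑-distrib-+

    sum-comm : ∀ {m n} (f : Fin m → Fin n → ℕ) →
               sum (λ i → sum (λ j → f i j)) ≡ sum (λ j → sum (λ i → f i j))
    sum-comm = Sum.∑-comm

    sum-zero : ∀ {n} {f : Fin n → ℕ} → (∀ i → f i ≡ 0) → sum f ≡ 0
    sum-zero {n} h = trans (Sum.sum-cong-≗ {n} h) (Sum.sum-replicate-zero n)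

    sum-mono : ∀ {n} {f g : Fin n → ℕ} → (∀ i → f i ≤ g i) → sum f ≤ sum g
    sum-mono {zero}  h = z≤n
    sum-mono {suc n} h = +-mono-≤ (h zero) (sum-mono (h ∘ suc))

    sum-mono-< : ∀ {n} {f g : Fin n → ℕ} → (∀ i → f i ≤ g i) → ∀ i → f i < g i → sum f < sum g
    sum-mono-< h zero    lt = +-mono-<-≤ lt (sum-mono (h ∘ suc))
    sum-mono-< h (suc i) lt = +-mono-≤-< (h zero) (sum-mono-< (h ∘ suc) i lt)

    sum-*ˡ : ∀ {n} c (f : Fin n → ℕ) → sum (λ i → c * f i) ≡ c * sum f
    sum-*ˡ {zero}  c f = sym (*-zeroʳ c)
    sum-*ˡ {suc n} c f = trans (cong (c * f zero +_) (sum-*ˡ c (f ∘ suc)))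
                               (sym (*-distribˡ-+ c (f zero) _))

    sum-δ : ∀ {n} (i : Fin n) → sum (λ j → 𝟙 (j Fin.≟ i)) ≡ 1
    sum-δ {suc n} zero    = cong suc (sum-zero {n} λ j → 𝟙-no (suc j Fin.≟ zero) (λ ()))
    sum-δ {suc n} (suc i) = trans (sum-cong λ j → 𝟙-cong (suc j Fin.≟ suc i) (j Fin.≟ i) Fin.suc-injective (cong suc)) (sum-δ i)

    length-filter-tabulate : ∀ {a p n} {A : Set a} {P : Pred A p} (P? : Decidable P) (f : Fin n → A) →
                             length (filter P? (List.tabulate f)) ≡ sum (λ i → 𝟙 (P? (f i)))
    length-filter-tabulate {n = zero}  P? f = refl
    length-filter-tabulate {n = suc n} P? f with does (P? (f zero))
    ... | true  = cong suc (length-filter-tabulate P? (f ∘ suc))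
    ... | false = length-filter-tabulate P? (f ∘ suc)

    ∣∣≡sum : ∀ {n} (p : Subset n) → ∣ p ∣ ≡ sum (λ i → 𝟙 (i ∈? p))
    ∣∣≡sum []            = refl
    ∣∣≡sum (inside  ∷ p) = cong suc (trans (∣∣≡sum p) (sum-cong λ i → 𝟙-cong (i ∈? p) (suc i ∈? inside ∷ p) there drop-there))
    ∣∣≡sum (outside ∷ p) = trans (∣∣≡sum p) (sum-cong λ i → 𝟙-cong (i ∈? p) (suc i ∈? outside ∷ p) there drop-there)

  length-filter-map : ∀ {a b p} {A : Set a} {B : Set b} {P : Pred B p} (P? : Decidable P) (f : A → B) xs →
                      length (filter P? (List.map f xs)) ≡ length (filter (P? ∘ f) xs)
  length-filter-map P? f []       = refl
  length-filter-map P? f (x ∷ xs) with does (P? (f x))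
  ... | true  = cong suc (length-filter-map P? f xs)
  ... | false = length-filter-map P? f xs

  length-filter-product : ∀ {a p m n} {A : Set a} {P : Pred (A × Fin n) p} (P? : Decidable P) (f : Fin m → A) →
    length (filter P? (cartesianProduct (List.tabulate f) (allFin n))) ≡ sum (λ i → sum (λ j → 𝟙 (P? (f i , j))))
  length-filter-product {m = zero}            P? f = sym sum-[]
  length-filter-product {m = suc m} {n = n} P? f = begin
    length (filter P? (row ++ rest))                    ≡⟨ cong length (filter-++ P? row rest) ⟩
    length (filter P? row ++ filter P? rest)            ≡⟨ length-++ (filter P? row) ⟩
    length (filter P? row) + length (filter P? rest)    ≡⟨ cong₂ _+_ first (length-filter-product P? (f ∘ suc)) ⟩
    sum (λ j → 𝟙 (P? (f zero , j))) + sum (λ i → sum (λ j → 𝟙 (P? (f (suc i) , j)))) ≡⟨ sym (sum-∷ _) ⟩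
    sum (λ i → sum (λ j → 𝟙 (P? (f i , j))))            ∎
    where
    open ≡-Reasoning
    row  = List.map (f zero ,_) (allFin n)
    rest = cartesianProduct (List.tabulate (f ∘ suc)) (allFin n)
    first = trans (length-filter-map P? (f zero ,_) (allFin n)) (length-filter-tabulate (λ j → P? (f zero , j)) (λ j → j))

  sum-sum-+ : ∀ {m n} (f g : Fin m → Fin n → ℕ) →
              sum (λ i → sum λ j → f i j + g i j) ≡ sum (λ i → sum (f i)) + sum (λ i → sum (g i))
  sum-sum-+ f g = trans (sum-cong λ i → sum-+ (f i) (g i)) (sum-+ _ _)

  length-filter-filter : ∀ {a p q} {A : Set a} {P : Pred A p} {Q : Pred A q}
    (P? : Decidable P) (Q? : Decidable Q) xs →
    length (filter Q? (filter P? xs)) ≡ length (filter (λ x → P? x ×-dec Q? x) xs)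
  length-filter-filter P? Q? [] = refl
  length-filter-filter P? Q? (x ∷ xs) with does (P? x)
  ... | false = length-filter-filter P? Q? xs
  ... | true with does (Q? x)
  ...   | true  = cong suc (length-filter-filter P? Q? xs)
  ...   | false = length-filter-filter P? Q? xs

  -- Turns counts of edges, which are listed with the smaller end first, into sums over all ordered
  -- pairs, where degrees and deletions can be compared entry by entry.
  handshake : ∀ {n} {P : Fin n → Fin n → Set} (P? : ∀ i j → Dec (P i j)) →
              (∀ {i j} → P i j → P j i) → (∀ {i} → ¬ P i i) →
              2 * sum (λ i → sum λ j → 𝟙 (i Fin.<? j ×-dec P? i j)) ≡ sum (λ i → sum λ j → 𝟙 (P? i j))
  handshake {n} P? P-sym P-irr = begin
    2 * S                                       ≡⟨ cong (S +_) (+-identityʳ S) ⟩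
    S + S                                       ≡⟨ cong (S +_) (sum-comm below) ⟩
    S + sum (λ i → sum λ j → below j i)         ≡⟨ sym (sum-+ _ _) ⟩
    sum (λ i → sum (below i) + sum λ j → below j i) ≡⟨ sum-cong (λ i → sym (sum-+ (below i) _)) ⟩
    sum (λ i → sum λ j → below i j + below j i) ≡⟨ sum-cong (λ i → sum-cong (pointwise i)) ⟩
    sum (λ i → sum λ j → 𝟙 (P? i j))            ∎
    where
    open ≡-Reasoning
    below : Fin n → Fin n → ℕ
    below i j = 𝟙 (i Fin.<? j ×-dec P? i j)
    S = sum (λ i → sum (below i))
    pointwise : ∀ i j → below i j + below j i ≡ 𝟙 (P? i j)
    pointwise i j with Fin.<-cmp i j
    ... | tri< i<j _ j≮i = trans (cong₂ _+_ (𝟙-cong (i Fin.<? j ×-dec P? i j) (P? i j) proj₂ (i<j ,_))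
                                            (𝟙-no (j Fin.<? i ×-dec P? j i) (j≮i ∘ proj₁)))
                                 (+-identityʳ _)
    ... | tri> i≮j _ j<i = trans (cong (_+ below j i) (𝟙-no (i Fin.<? j ×-dec P? i j) (i≮j ∘ proj₁)))
                                 (𝟙-cong (j Fin.<? i ×-dec P? j i) (P? i j) (P-sym ∘ proj₂) (λ p → j<i , P-sym p))
    ... | tri≈ i≮i refl _ = trans (cong₂ _+_ (𝟙-no (i Fin.<? i ×-dec P? i i) (i≮i ∘ proj₁))
                                             (𝟙-no (i Fin.<? i ×-dec P? i i) (i≮i ∘ proj₁)))
                                  (sym (𝟙-no (P? i i) P-irr))

  ∈-tabulate⁺ : ∀ {n} {P : Fin n → Set} (P? : ∀ v → Dec (P v)) {v} → P v → v ∈ tabulate (λ u → does (P? u))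
  ∈-tabulate⁺ P? {v} p = lookup⇒[]= v _ (trans (lookup∘tabulate _ v) (dec-true (P? v) p))

  ∈-tabulate⁻ : ∀ {n} {P : Fin n → Set} (P? : ∀ v → Dec (P v)) {v} → v ∈ tabulate (λ u → does (P? u)) → P v
  ∈-tabulate⁻ P? {v} i with P? v | trans (sym (lookup∘tabulate (λ u → does (P? u)) v)) ([]=⇒lookup i)
  ... | yes p | _ = p
  ... | no _  | ()

  ∣tabulate∣ : ∀ {n} {P : Fin n → Set} (P? : ∀ v → Dec (P v)) →
               ∣ tabulate (λ u → does (P? u)) ∣ ≡ sum (λ v → 𝟙 (P? v))
  ∣tabulate∣ P? = trans (∣∣≡sum _) (sum-cong λ v → 𝟙-cong (v ∈? _) (P? v) (∈-tabulate⁻ P?) (∈-tabulate⁺ P?))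

  -- Pads the middle of a separation to the exact size that `IsSeparator` demands.
  subset-between : ∀ {n} {p q : Subset n} {j} → p ⊆ q → ∣ p ∣ ≤ j → j ≤ ∣ q ∣ →
                   ∃[ r ] p ⊆ r × r ⊆ q × ∣ r ∣ ≡ j
  subset-between {p = []} {[]} p⊆q z≤n z≤n = [] , ⊆-refl , ⊆-refl , refl
  subset-between {p = inside ∷ p} {outside ∷ q} p⊆q _ _ with () ← p⊆q here
  subset-between {p = inside ∷ p} {inside ∷ q} p⊆q (s≤s p≤j) (s≤s j≤q)
    with r , p⊆r , r⊆q , eq ← subset-between (drop-∷-⊆ p⊆q) p≤j j≤q
    = inside ∷ r , in⊆in p⊆r , in⊆in r⊆q , cong suc eq
  subset-between {p = outside ∷ p} {outside ∷ q} p⊆q p≤j j≤q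
    with r , p⊆r , r⊆q , eq ← subset-between (drop-∷-⊆ p⊆q) p≤j j≤q
    = outside ∷ r , out⊆ p⊆r , out⊆ r⊆q , eq
  subset-between {p = outside ∷ p} {inside ∷ q} {j} p⊆q p≤j j≤q with j ≤? ∣ q ∣
  ... | yes j≤q′ with r , p⊆r , r⊆q , eq ← subset-between (drop-∷-⊆ p⊆q) p≤j j≤q′
        = outside ∷ r , out⊆ p⊆r , out⊆ r⊆q , eq
  ... | no j≰q = inside ∷ q , p⊆q , ⊆-refl , ≤-antisym (≰⇒> j≰q) j≤q

  -- Separations as labellings

  -- A separation (A, S, B) is the labelling with L on A, M on S and R on B.
  Side : Set
  Side = Fin 3

  pattern L = zero
  pattern M = suc zero
  pattern R = suc (suc zero)

  opp : Side → Side
  opp L = R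
  opp M = M
  opp R = L

  -- The join in L < M < R.  The join of the labellings of (A, S, B) and (C, T, D) is L
  -- on the corner A ∩ C and M on the vertices that separate this corner from the rest.
  infixl 6 _⊔ˢ_
  _⊔ˢ_ : Side → Side → Side
  L ⊔ˢ t = t
  M ⊔ˢ L = M
  M ⊔ˢ M = M
  M ⊔ˢ R = R
  R ⊔ˢ t = R

  ⟦_∶_⟧ : Side → Side → ℕ
  ⟦ s ∶ t ⟧ = 𝟙 (s Fin.≟ t)

  L≢R : _≢_ {A = Side} L R
  L≢R ()

  L≢M : _≢_ {A = Side} L M
  L≢M ()

  R≢M : _≢_ {A = Side} R M
  R≢M ()

  opp-L : ∀ {s} → opp s ≡ L → s ≡ R
  opp-L {R} _ = refl

  opp-R : ∀ {s} → opp s ≡ R → s ≡ L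
  opp-R {L} _ = refl
  opp-R {M} ()
  opp-R {R} ()

  ⊔ˢ-L : ∀ {s t} → s ⊔ˢ t ≡ L → s ≡ L × t ≡ L
  ⊔ˢ-L {L} e = refl , e
  ⊔ˢ-L {M} {L} ()
  ⊔ˢ-L {M} {M} ()
  ⊔ˢ-L {M} {R} ()
  ⊔ˢ-L {R} ()

  ⊔ˢ-R : ∀ {s t} → s ⊔ˢ t ≡ R → s ≡ R ⊎ t ≡ R
  ⊔ˢ-R {L}     e = inj₂ e
  ⊔ˢ-R {M} {R} e = inj₂ e
  ⊔ˢ-R {R}     e = inj₁ e

  ⊔ˢ-R⁺ʳ : ∀ {s t} → t ≡ R → s ⊔ˢ t ≡ R
  ⊔ˢ-R⁺ʳ {L} refl = refl
  ⊔ˢ-R⁺ʳ {M} refl = refl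
  ⊔ˢ-R⁺ʳ {R} refl = refl

  private
    ∀² : ∀ {p} {P : Side → Side → Set p} → (∀ s t → Dec (P s t)) → Dec (∀ s t → P s t)
    ∀² P? = Fin.all? λ s → Fin.all? (P? s)

  -- Submodularity for opposite corners, localised to a single vertex: only nine positions are
  -- possible, so a decision procedure settles it.
  corners-cells : ∀ s t → ⟦ s ⊔ˢ t ∶ M ⟧ + ⟦ opp s ⊔ˢ opp t ∶ M ⟧ ≤ ⟦ s ∶ M ⟧ + ⟦ t ∶ M ⟧
  corners-cells = from-yes (∀² λ s t → ⟦ s ⊔ˢ t ∶ M ⟧ + ⟦ opp s ⊔ˢ opp t ∶ M ⟧ ≤? ⟦ s ∶ M ⟧ + ⟦ t ∶ M ⟧)

  -- When the cell `R`, `R` is excluded, a position in `R` or `M` of the first labelling lies in `L`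
  -- of the second or in the middle around the empty corner. The cell `L`, `L` counts only on the
  -- right, which is the source of strictness in `shrink-<`.
  shrink-cells : ∀ s t → ¬ (s ≡ R × t ≡ R) → ⟦ s ∶ R ⟧ + ⟦ s ∶ M ⟧ ≤ ⟦ t ∶ L ⟧ + ⟦ opp s ⊔ˢ opp t ∶ M ⟧
  shrink-cells = from-yes (∀² λ s t → ¬? (s Fin.≟ R ×-dec t Fin.≟ R) →-dec
                                      (⟦ s ∶ R ⟧ + ⟦ s ∶ M ⟧ ≤? ⟦ t ∶ L ⟧ + ⟦ opp s ⊔ˢ opp t ∶ M ⟧))

  -- Concerns the two corners in `R` of the second labelling. Their middles count a vertex of S at
  -- most twice and a vertex of T outside S once, and they miss D, so D can be added twice.
  crossed-cells : ∀ s t → (t ≡ L → s ≡ M) →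
    ⟦ opp s ⊔ˢ opp t ∶ M ⟧ + ⟦ opp (opp s) ⊔ˢ opp t ∶ M ⟧ + (⟦ t ∶ L ⟧ + ⟦ t ∶ L ⟧) ≤ ⟦ s ∶ M ⟧ + ⟦ s ∶ M ⟧ + ⟦ t ∶ M ⟧
  crossed-cells = from-yes (∀² λ s t → (t Fin.≟ L →-dec s Fin.≟ M) →-dec
    (⟦ opp s ⊔ˢ opp t ∶ M ⟧ + ⟦ opp (opp s) ⊔ˢ opp t ∶ M ⟧ + (⟦ t ∶ L ⟧ + ⟦ t ∶ L ⟧) ≤? ⟦ s ∶ M ⟧ + ⟦ s ∶ M ⟧ + ⟦ t ∶ M ⟧))

  -- Counting vertices by label

  module VertexSums {N : ℕ} (G : Graph N) where

    ∑ᵥ : (Fin N → ℕ) → ℕ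
    ∑ᵥ f = sum (λ v → 𝟙 (v ∈? V G) * f v)

    ∑ᵥ-+ : ∀ f g → ∑ᵥ (λ v → f v + g v) ≡ ∑ᵥ f + ∑ᵥ g
    ∑ᵥ-+ f g = trans (sum-cong λ v → *-distribˡ-+ (𝟙 (v ∈? V G)) (f v) (g v)) (sum-+ _ _)

    private
      on-V-mono : ∀ {f g : Fin N → ℕ} → (∀ v → v ∈ V G → f v ≤ g v) → ∀ v → 𝟙 (v ∈? V G) * f v ≤ 𝟙 (v ∈? V G) * g v
      on-V-mono h v with v ∈? V G
      ... | yes v∈ = +-monoˡ-≤ 0 (h v v∈)
      ... | no _   = z≤n

    ∑ᵥ-mono : ∀ {f g} → (∀ v → v ∈ V G → f v ≤ g v) → ∑ᵥ f ≤ ∑ᵥ g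
    ∑ᵥ-mono h = sum-mono (on-V-mono h)

    ∑ᵥ-mono-< : ∀ {f g} → (∀ v → v ∈ V G → f v ≤ g v) → ∀ {v} → v ∈ V G → f v < g v → ∑ᵥ f < ∑ᵥ g
    ∑ᵥ-mono-< {f} {g} h {v} v∈ lt = sum-mono-< (on-V-mono h) v strict
      where
      strict : 𝟙 (v ∈? V G) * f v < 𝟙 (v ∈? V G) * g v
      strict rewrite 𝟙-yes (v ∈? V G) v∈ = +-monoˡ-< 0 lt

    ∑ᵥ≤sum : ∀ f → ∑ᵥ f ≤ sum f
    ∑ᵥ≤sum f = sum-mono λ v → ≤-trans (*-monoˡ-≤ (f v) (𝟙≤1 (v ∈? V G))) (≤-reflexive (*-identityˡ (f v)))

    ∑ᵥ-δ≤1 : ∀ u → ∑ᵥ (λ v → 𝟙 (v Fin.≟ u)) ≤ 1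
    ∑ᵥ-δ≤1 u = ≤-trans (∑ᵥ≤sum _) (≤-reflexive (sum-δ u))

    order≡∑ᵥ : order G ≡ ∑ᵥ (λ _ → 1)
    order≡∑ᵥ = trans (∣∣≡sum (V G)) (sum-cong λ v → sym (*-identityʳ _))

    adj⇒∈Vʳ : ∀ {u v} → Adj G u v → v ∈ V G
    adj⇒∈Vʳ a = adj⇒∈V G (adj-sym G a)

    degree≡sum : ∀ u → degree G u ≡ sum (λ v → 𝟙 (adj? G u v))
    degree≡sum u = length-filter-tabulate (adj? G u) id

    degree-≤ : ∀ u {f} → (∀ v → Adj G u v → 1 ≤ f v) → degree G u ≤ ∑ᵥ f
    degree-≤ u {f} h = ≤-trans (≤-reflexive (degree≡sum u)) (sum-mono pointwise)
      where
      pointwise : ∀ v → 𝟙 (adj? G u v) ≤ 𝟙 (v ∈? V G) * f v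
      pointwise v with adj? G u v
      ... | no _  = z≤n
      ... | yes a rewrite 𝟙-yes (v ∈? V G) (adj⇒∈Vʳ a) = ≤-trans (h v a) (≤-reflexive (sym (+-identityʳ (f v))))

    -- Labels of non-vertices are junk, so labels are only ever counted on V G.
    Label : Set
    Label = Fin N → Side

    # : Side → Label → ℕ
    # s ρ = ∑ᵥ λ v → ⟦ ρ v ∶ s ⟧

    ∣_∣ᴹ : Label → ℕ
    ∣ ρ ∣ᴹ = # M ρ

    infixl 6 _⊔ᴸ_
    _⊔ᴸ_ : Label → Label → Label
    (σ ⊔ᴸ τ) v = σ v ⊔ˢ τ v

    ⊔ᴸ-L : ∀ σ τ {v} → (σ ⊔ᴸ τ) v ≡ L → σ v ≡ L × τ v ≡ L
    ⊔ᴸ-L σ τ {v} = ⊔ˢ-L {σ v} {τ v}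

    infixl 8 _ᵒ _⟨_⟩
    _ᵒ : Label → Label
    (ρ ᵒ) v = opp (ρ v)

    -- Moving `y` into the middle removes every crossing edge at `y`, at the cost of one more middle
    -- vertex.
    _⟨_⟩ : Label → Fin N → Label
    (ρ ⟨ y ⟩) v = if does (v Fin.≟ y) then M else ρ v

    ⟨⟩-≢ : ∀ ρ {y v} → v ≢ y → (ρ ⟨ y ⟩) v ≡ ρ v
    ⟨⟩-≢ ρ {y} {v} v≢y rewrite dec-false (v Fin.≟ y) v≢y = refl

    ⟨⟩-≢M : ∀ ρ {y v s} → (ρ ⟨ y ⟩) v ≡ s → s ≢ M → v ≢ y × ρ v ≡ s
    ⟨⟩-≢M ρ {y} {v} e s≢M with v Fin.≟ y
    ... | yes _  = ⊥-elim (s≢M (sym e))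
    ... | no v≢y = v≢y , e

    ⟨⟩-L : ∀ ρ {y v} → (ρ ⟨ y ⟩) v ≡ L → v ≢ y × ρ v ≡ L
    ⟨⟩-L ρ e = ⟨⟩-≢M ρ e λ ()

    ⟨⟩-R : ∀ ρ {y v} → (ρ ⟨ y ⟩) v ≡ R → v ≢ y × ρ v ≡ R
    ⟨⟩-R ρ e = ⟨⟩-≢M ρ e λ ()

    ⟨⟩-size : ∀ ρ y → ∣ ρ ⟨ y ⟩ ∣ᴹ ≤ suc ∣ ρ ∣ᴹ
    ⟨⟩-size ρ y = begin
      ∣ ρ ⟨ y ⟩ ∣ᴹ                                ≤⟨ ∑ᵥ-mono pointwise ⟩
      ∑ᵥ (λ v → 𝟙 (v Fin.≟ y) + ⟦ ρ v ∶ M ⟧)     ≡⟨ ∑ᵥ-+ _ _ ⟩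
      ∑ᵥ (λ v → 𝟙 (v Fin.≟ y)) + ∣ ρ ∣ᴹ          ≤⟨ +-monoˡ-≤ _ (∑ᵥ-δ≤1 y) ⟩
      suc ∣ ρ ∣ᴹ                                  ∎
      where
      open ≤-Reasoning
      pointwise : ∀ v → v ∈ V G → ⟦ (ρ ⟨ y ⟩) v ∶ M ⟧ ≤ 𝟙 (v Fin.≟ y) + ⟦ ρ v ∶ M ⟧
      pointwise v _ with v Fin.≟ y
      ... | yes _ = s≤s z≤n
      ... | no _  = ≤-refl

    corners-≤ : ∀ σ τ → ∣ σ ⊔ᴸ τ ∣ᴹ + ∣ σ ᵒ ⊔ᴸ τ ᵒ ∣ᴹ ≤ ∣ σ ∣ᴹ + ∣ τ ∣ᴹ
    corners-≤ σ τ = subst₂ _≤_ (∑ᵥ-+ _ _) (∑ᵥ-+ _ _) (∑ᵥ-mono λ v _ → corners-cells (σ v) (τ v))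

    NoRR : Label → Label → Set
    NoRR σ τ = ∀ {v} → v ∈ V G → σ v ≡ R → τ v ≡ R → ⊥

    shrink-≤ : ∀ σ τ → NoRR σ τ → # R σ + ∣ σ ∣ᴹ ≤ # L τ + ∣ σ ᵒ ⊔ᴸ τ ᵒ ∣ᴹ
    shrink-≤ σ τ noRR = subst₂ _≤_ (∑ᵥ-+ _ _) (∑ᵥ-+ _ _)
      (∑ᵥ-mono λ v v∈ → shrink-cells (σ v) (τ v) λ (p , q) → noRR v∈ p q)

    shrink-< : ∀ σ τ → NoRR σ τ → ∀ {y} → y ∈ V G → σ y ≡ L → τ y ≡ L →
               # R σ + ∣ σ ∣ᴹ < # L τ + ∣ σ ᵒ ⊔ᴸ τ ᵒ ∣ᴹ
    shrink-< σ τ noRR {y} y∈ σy τy = subst₂ _<_ (∑ᵥ-+ _ _) (∑ᵥ-+ _ _)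
      (∑ᵥ-mono-< (λ v v∈ → shrink-cells (σ v) (τ v) λ (p , q) → noRR v∈ p q) y∈ strict)
      where
      strict : ⟦ σ y ∶ R ⟧ + ⟦ σ y ∶ M ⟧ < ⟦ τ y ∶ L ⟧ + ⟦ opp (σ y) ⊔ˢ opp (τ y) ∶ M ⟧
      strict rewrite σy | τy = s≤s z≤n

    crossed-≤ : ∀ σ τ → (∀ {v} → v ∈ V G → τ v ≡ L → σ v ≡ M) →
      ∣ σ ᵒ ⊔ᴸ τ ᵒ ∣ᴹ + ∣ σ ᵒ ᵒ ⊔ᴸ τ ᵒ ∣ᴹ + (# L τ + # L τ) ≤ ∣ σ ∣ᴹ + ∣ σ ∣ᴹ + ∣ τ ∣ᴹ
    crossed-≤ σ τ D⊆M = begin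
      ∣ σ ᵒ ⊔ᴸ τ ᵒ ∣ᴹ + ∣ σ ᵒ ᵒ ⊔ᴸ τ ᵒ ∣ᴹ + (# L τ + # L τ)
        ≡⟨ cong₂ _+_ (∑ᵥ-+ _ _) (∑ᵥ-+ _ _) ⟨
      ∑ᵥ (λ v → ⟦ opp (σ v) ⊔ˢ opp (τ v) ∶ M ⟧ + ⟦ opp (opp (σ v)) ⊔ˢ opp (τ v) ∶ M ⟧)
        + ∑ᵥ (λ v → ⟦ τ v ∶ L ⟧ + ⟦ τ v ∶ L ⟧)
        ≡⟨ ∑ᵥ-+ _ _ ⟨
      ∑ᵥ (λ v → ⟦ opp (σ v) ⊔ˢ opp (τ v) ∶ M ⟧ + ⟦ opp (opp (σ v)) ⊔ˢ opp (τ v) ∶ M ⟧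
                + (⟦ τ v ∶ L ⟧ + ⟦ τ v ∶ L ⟧))
        ≤⟨ ∑ᵥ-mono (λ v v∈ → crossed-cells (σ v) (τ v) (D⊆M v∈)) ⟩
      ∑ᵥ (λ v → ⟦ σ v ∶ M ⟧ + ⟦ σ v ∶ M ⟧ + ⟦ τ v ∶ M ⟧)
        ≡⟨ ∑ᵥ-+ _ _ ⟩
      ∑ᵥ (λ v → ⟦ σ v ∶ M ⟧ + ⟦ σ v ∶ M ⟧) + ∣ τ ∣ᴹ
        ≡⟨ cong (_+ ∣ τ ∣ᴹ) (∑ᵥ-+ _ _) ⟩
      ∣ σ ∣ᴹ + ∣ σ ∣ᴹ + ∣ τ ∣ᴹ ∎
      where open ≤-Reasoning

    #L-ᵒ : ∀ ρ → # L (ρ ᵒ) ≡ # R ρ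
    #L-ᵒ ρ = sum-cong λ v → cong (𝟙 (v ∈? V G) *_) (swap (ρ v))
      where
      swap : ∀ s → ⟦ opp s ∶ L ⟧ ≡ ⟦ s ∶ R ⟧
      swap = from-yes (Fin.all? λ s → ⟦ opp s ∶ L ⟧ ≟ ⟦ s ∶ R ⟧)

    #M-ᵒ : ∀ ρ → ∣ ρ ᵒ ∣ᴹ ≡ ∣ ρ ∣ᴹ
    #M-ᵒ ρ = sum-cong λ v → cong (𝟙 (v ∈? V G) *_) (swap (ρ v))
      where
      swap : ∀ s → ⟦ opp s ∶ M ⟧ ≡ ⟦ s ∶ M ⟧
      swap = from-yes (Fin.all? λ s → ⟦ opp s ∶ M ⟧ ≟ ⟦ s ∶ M ⟧)

  -- Separations of single edges in a k-connected graph, with κ = k - 1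

  module Separations {N : ℕ} (G : Graph N) (κ : ℕ) (kc : KConnected (suc κ) G) where
    open VertexSums G public

    -- The middle is only bounded by κ, since corners come with upper bounds; `thick` recovers
    -- equality when the end `a` has degree above k.
    record Sep (a b : Fin N) (ρ : Label) : Set where
      field
        left  : ρ a ≡ L
        right : ρ b ≡ R
        only  : ∀ {u v} → Adj G u v → ρ u ≡ L → ρ v ≡ R → u ≡ a × v ≡ b
        thin  : ∣ ρ ∣ᴹ ≤ κ
    open Sep public

    flip : ∀ {a b ρ} → Sep a b ρ → Sep b a (ρ ᵒ)
    flip {ρ = ρ} s = record
      { left  = cong opp (right s)
      ; right = cong opp (left s)
      ; only  = λ a u v → let p , q = only s (adj-sym G a) (opp-R v) (opp-L u) in q , p
      ; thin  = subst (_≤ κ) (sym (#M-ᵒ ρ)) (thin s)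
      }

    -- The start of an edge leaving a corner is `L` in both labellings and its end is `R` in at
    -- least one, so the edge crosses one of the two separations.
    ⊔-only : ∀ {a b c d σ τ} → Sep a b σ → Sep c d τ → ∀ {u v} → Adj G u v →
             (σ ⊔ᴸ τ) u ≡ L → (σ ⊔ᴸ τ) v ≡ R → (u ≡ a × v ≡ b) ⊎ (u ≡ c × v ≡ d)
    ⊔-only s t a u v with ⊔ˢ-L u | ⊔ˢ-R v
    ... | σu , τu | inj₁ σv = inj₁ (only s a σu σv)
    ... | σu , τu | inj₂ τv = inj₂ (only t a τu τv)

    corners-κ : ∀ {a b c d σ τ} → Sep a b σ → Sep c d τ → ∣ σ ⊔ᴸ τ ∣ᴹ + ∣ σ ᵒ ⊔ᴸ τ ᵒ ∣ᴹ ≤ κ + κ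
    corners-κ {σ = σ} {τ} s t = ≤-trans (corners-≤ σ τ) (+-mono-≤ (thin s) (thin t))

    -- Otherwise the middle could be padded to exactly κ vertices without using `a` or `b`, which is
    -- possible since G has more than k vertices, and the result would be a forbidden separator.
    separates⇒large : ∀ ρ → (∀ {u v} → Adj G u v → ρ u ≡ L → ρ v ≡ R → ⊥) →
                      ∀ {a b} → a ∈ V G → ρ a ≡ L → b ∈ V G → ρ b ≡ R → κ < ∣ ρ ∣ᴹ
    separates⇒large ρ none {a} {b} a∈ ρa b∈ ρb = ≰⇒> λ small →
      let S , U⊆S , S⊆W , ∣S∣ = subset-between U⊆W (≤-trans (≤-reflexive ∣U∣) small) κ≤∣W∣
          in-W : ∀ {v} → v ∈ S → v ∈ V G × v ≢ a × v ≢ b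
          in-W = ∈-tabulate⁻ W? ∘ S⊆W
          a∈′ = x∈p∧x∉q⇒x∈p─q a∈ λ i → proj₁ (proj₂ (in-W i)) refl
          b∈′ = x∈p∧x∉q⇒x∈p─q b∈ λ i → proj₂ (proj₂ (in-W i)) refl
      in proj₂ kc refl S (proj₁ ∘ in-W , ∣S∣ , λ conn → L≢R (trans (sym (stays-L U⊆S ρa (conn a∈′ b∈′))) ρb))
      where
      U? : ∀ v → Dec (v ∈ V G × ρ v ≡ M)
      U? v = v ∈? V G ×-dec ρ v Fin.≟ M
      W? : ∀ v → Dec (v ∈ V G × v ≢ a × v ≢ b)
      W? v = v ∈? V G ×-dec ¬? (v Fin.≟ a) ×-dec ¬? (v Fin.≟ b)
      U W : Subset N
      U = tabulate λ v → does (U? v)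
      W = tabulate λ v → does (W? v)
      U⊆W : U ⊆ W
      U⊆W i = let v∈ , ρv = ∈-tabulate⁻ U? i in
        ∈-tabulate⁺ W? (v∈ , (λ { refl → L≢M (trans (sym ρa) ρv) }) , (λ { refl → R≢M (trans (sym ρb) ρv) }))
      stays-L : ∀ {S} → U ⊆ S → ∀ {u v} → ρ u ≡ L → Reachable (deleteVertices G S) u v → ρ v ≡ L
      stays-L U⊆S p ε = p
      stays-L U⊆S p (_◅_ {j = w} (e , _ , w∉S) r) with ρ w in ρw
      ... | L = stays-L U⊆S ρw r
      ... | M = ⊥-elim (w∉S (U⊆S (∈-tabulate⁺ U? (adj⇒∈Vʳ e , ρw))))
      ... | R = ⊥-elim (none e p ρw)
      ∣U∣ : ∣ U ∣ ≡ ∣ ρ ∣ᴹ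
      ∣U∣ = trans (∣tabulate∣ U?) (sum-cong pointwise)
        where
        pointwise : ∀ v → 𝟙 (U? v) ≡ 𝟙 (v ∈? V G) * ⟦ ρ v ∶ M ⟧
        pointwise v with does (v ∈? V G)
        ... | true  = sym (+-identityʳ _)
        ... | false = refl
      κ≤∣W∣ : κ ≤ ∣ W ∣
      κ≤∣W∣ = +-cancelˡ-≤ 2 κ ∣ W ∣ (begin
        2 + κ                                       ≤⟨ proj₁ kc ⟩
        order G                                     ≡⟨ order≡∑ᵥ ⟩
        ∑ᵥ (λ _ → 1)                                ≤⟨ ∑ᵥ-mono pointwise ⟩
        ∑ᵥ (λ v → 𝟙 (v Fin.≟ a) + 𝟙 (v Fin.≟ b) + 𝟙 (W? v)) ≡⟨ ∑ᵥ-+ _ _ ⟩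
        ∑ᵥ (λ v → 𝟙 (v Fin.≟ a) + 𝟙 (v Fin.≟ b)) + ∑ᵥ (λ v → 𝟙 (W? v)) ≡⟨ cong (_+ ∑ᵥ (λ v → 𝟙 (W? v))) (∑ᵥ-+ _ _) ⟩
        ∑ᵥ (λ v → 𝟙 (v Fin.≟ a)) + ∑ᵥ (λ v → 𝟙 (v Fin.≟ b)) + ∑ᵥ (λ v → 𝟙 (W? v))
          ≤⟨ +-mono-≤ (+-mono-≤ (∑ᵥ-δ≤1 a) (∑ᵥ-δ≤1 b)) (∑ᵥ≤sum _) ⟩
        2 + sum (λ v → 𝟙 (W? v))                    ≡⟨ cong (2 +_) (∣tabulate∣ W?) ⟨
        2 + ∣ W ∣                                   ∎)
        where
        open ≤-Reasoning
        pointwise : ∀ v → v ∈ V G → 1 ≤ 𝟙 (v Fin.≟ a) + 𝟙 (v Fin.≟ b) + 𝟙 (W? v)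
        pointwise v v∈ with v Fin.≟ a | v Fin.≟ b
        ... | yes _ | _     = s≤s z≤n
        ... | no _  | yes _ = s≤s z≤n
        ... | no p  | no q  rewrite dec-true (v ∈? V G) v∈ = s≤s z≤n

    -- Take `a` as the left side and its neighbours as the middle. If there are at most κ
    -- neighbours, the right side must be empty, so G has at most k vertices.
    k≤degree : ∀ {a} → a ∈ V G → κ < degree G a
    k≤degree {a} a∈ = ≰⇒> λ d≤κ → <⇒≱ (proj₁ kc) (begin
      order G                                                ≡⟨ order≡∑ᵥ ⟩
      ∑ᵥ (λ _ → 1)                                           ≤⟨ ∑ᵥ-mono (pointwise d≤κ) ⟩
      ∑ᵥ (λ v → 𝟙 (v Fin.≟ a) + 𝟙 (adj? G a v))              ≡⟨ ∑ᵥ-+ _ _ ⟩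
      ∑ᵥ (λ v → 𝟙 (v Fin.≟ a)) + ∑ᵥ (λ v → 𝟙 (adj? G a v))   ≤⟨ +-mono-≤ (∑ᵥ-δ≤1 a) (∑ᵥ≤sum _) ⟩
      1 + sum (λ v → 𝟙 (adj? G a v))                         ≡⟨ cong suc (degree≡sum a) ⟨
      suc (degree G a)                                       ≤⟨ s≤s d≤κ ⟩
      suc κ                                                  ∎)
      where
      open ≤-Reasoning
      ρ : Label
      ρ v = if does (v Fin.≟ a) then L else if does (adj? G a v) then M else R
      ρa : ρ a ≡ L
      ρa rewrite dec-true (a Fin.≟ a) refl = refl
      ρ-L : ∀ v → ρ v ≡ L → v ≡ a
      ρ-L v e with v Fin.≟ a | adj? G a v
      ... | yes p | _     = p
      ρ-L v () | no _ | yes _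
      ρ-L v () | no _ | no _
      ρ-R : ∀ v → ρ v ≡ R → ¬ Adj G a v
      ρ-R v e ad with v Fin.≟ a | adj? G a v
      ρ-R v () ad | yes _ | _
      ρ-R v () ad | no _ | yes _
      ... | no _ | no ¬p = ¬p ad
      none : ∀ {u v} → Adj G u v → ρ u ≡ L → ρ v ≡ R → ⊥
      none {u} {v} ad p q with refl ← ρ-L u p = ρ-R v q ad
      ∣ρ∣≤ : ∣ ρ ∣ᴹ ≤ degree G a
      ∣ρ∣≤ = ≤-trans (∑ᵥ≤sum _) (≤-trans (sum-mono cell) (≤-reflexive (sym (degree≡sum a))))
        where
        cell : ∀ v → ⟦ ρ v ∶ M ⟧ ≤ 𝟙 (adj? G a v)
        cell v with does (v Fin.≟ a) | does (adj? G a v)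
        ... | true  | _     = z≤n
        ... | false | true  = ≤-refl
        ... | false | false = z≤n
      pointwise : degree G a ≤ κ → ∀ v → v ∈ V G → 1 ≤ 𝟙 (v Fin.≟ a) + 𝟙 (adj? G a v)
      pointwise d≤κ v v∈ with v Fin.≟ a in eq₁ | adj? G a v in eq₂
      ... | yes _ | _     = s≤s z≤n
      ... | no _  | yes _ = s≤s z≤n
      ... | no p  | no q  = ⊥-elim (<⇒≱ (separates⇒large ρ none a∈ ρa v∈ ρv) (≤-trans ∣ρ∣≤ d≤κ))
        where
        ρv : ρ v ≡ R
        ρv rewrite eq₁ | eq₂ = refl

    -- If y were the whole L side its degree would be too small; otherwise
    -- moving y into the middle separates.
    two-exits⇒large : ∀ ρ {x y z} → suc κ < degree G y → y ∈ V G → ρ y ≡ L → x ∈ V G → ρ x ≡ R →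
      (∀ {u v} → Adj G u v → ρ u ≡ L → ρ v ≡ R → u ≡ y × (v ≡ x ⊎ v ≡ z)) → κ ≤ ∣ ρ ∣ᴹ
    two-exits⇒large ρ {x} {y} {z} deg y∈ ρy x∈ ρx exits = ≮⇒≥ λ small → narrow small
      where
      open ≤-Reasoning
      narrow : ∣ ρ ∣ᴹ < κ → ⊥
      narrow small with Fin.any? (λ v → v ∈? V G ×-dec ρ v Fin.≟ L ×-dec ¬? (v Fin.≟ y))
      ... | yes (a , a∈ , ρa , a≢y) = <⇒≱
        (separates⇒large (ρ ⟨ y ⟩)
          (λ ad p q → let u≢y , ρu = ⟨⟩-L ρ p in u≢y (proj₁ (exits ad ρu (proj₂ (⟨⟩-R ρ q)))))
          a∈ (trans (⟨⟩-≢ ρ a≢y) ρa) x∈ (trans (⟨⟩-≢ ρ x≢y) ρx))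
        (≤-trans (⟨⟩-size ρ y) small)
        where
        x≢y : x ≢ y
        x≢y refl with () ← trans (sym ρx) ρy
      ... | no none = <⇒≱ deg (begin
        degree G y                                                     ≤⟨ degree-≤ y neighbour ⟩
        ∑ᵥ (λ v → 𝟙 (v Fin.≟ x) + 𝟙 (v Fin.≟ z) + ⟦ ρ v ∶ M ⟧)        ≡⟨ ∑ᵥ-+ _ _ ⟩
        ∑ᵥ (λ v → 𝟙 (v Fin.≟ x) + 𝟙 (v Fin.≟ z)) + ∣ ρ ∣ᴹ              ≡⟨ cong (_+ ∣ ρ ∣ᴹ) (∑ᵥ-+ _ _) ⟩
        ∑ᵥ (λ v → 𝟙 (v Fin.≟ x)) + ∑ᵥ (λ v → 𝟙 (v Fin.≟ z)) + ∣ ρ ∣ᴹ   ≤⟨ +-monoˡ-≤ _ (+-mono-≤ (∑ᵥ-δ≤1 x) (∑ᵥ-δ≤1 z)) ⟩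
        2 + ∣ ρ ∣ᴹ                                                     ≤⟨ s≤s small ⟩
        suc κ                                                          ∎)
        where
        neighbour : ∀ v → Adj G y v → 1 ≤ 𝟙 (v Fin.≟ x) + 𝟙 (v Fin.≟ z) + ⟦ ρ v ∶ M ⟧
        neighbour v ad with ρ v in ρv
        ... | L = ⊥-elim (none (v , adj⇒∈Vʳ ad , ρv , λ { refl → irrefl G ad }))
        ... | M = m≤n+m 1 _
        ... | R with proj₂ (exits ad ρy ρv)
        ...   | inj₁ refl rewrite dec-true (x Fin.≟ x) refl = s≤s z≤n
        ...   | inj₂ refl rewrite dec-true (z Fin.≟ z) refl = ≤-trans (m≤n+m 1 (𝟙 (z Fin.≟ x))) (m≤m+n _ _)

    thick : ∀ {a b ρ} → suc κ < degree G a → a ∈ V G → b ∈ V G → Sep a b ρ → κ ≤ ∣ ρ ∣ᴹ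
    thick {b = b} {ρ} deg a∈ b∈ s = two-exits⇒large ρ {z = b} deg a∈ (left s) b∈ (right s)
      λ ad p q → let u≡ , v≡ = only s ad p q in u≡ , inj₁ v≡

  -- Minimally connected graphs

  module MinimallyConnected {N : ℕ} (G : Graph N) (κ : ℕ) (mkc : MinimallyKConnected (suc κ) G) where
    open Separations G κ (proj₁ mkc) public

    -- A cut S of `G - xy` with κ vertices becomes the middle, and the vertices that `x` still
    -- reaches become the left side. The search asks for an explicit unreachable pair, which keeps
    -- the property of S decidable.
    critical : ∀ {x y} → Adj G x y → ∃[ ρ ] Sep x y ρ
    critical {x} {y} xy with anySubset? cut?
      where
      G-e = deleteEdge G x y
      cut? : ∀ S → Dec (S ⊆ V G × ∣ S ∣ ≡ κ × ∃[ a ] ∃[ b ]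
               (a ∈ V (deleteVertices G-e S) × b ∈ V (deleteVertices G-e S) × ¬ Reachable (deleteVertices G-e S) a b))
      cut? S = (S ⊆? V G) ×-dec (∣ S ∣ ≟ κ) ×-dec Fin.any? λ a → Fin.any? λ b →
        (a ∈? V (deleteVertices G-e S)) ×-dec (b ∈? V (deleteVertices G-e S)) ×-dec
        ¬? (reachable? (deleteVertices G-e S) a b)
    ... | no ¬cut = ⊥-elim (proj₂ mkc x y xy (proj₁ (proj₁ mkc) , λ { refl S (S⊆V , ∣S∣ , ¬conn) →
      ¬conn λ {a} {b} a∈ b∈ → decidable-stable (reachable? (deleteVertices (deleteEdge G x y) S) a b) λ ¬r →
        ¬cut (S , S⊆V , ∣S∣ , a , b , a∈ , b∈ , ¬r) }))
    ... | yes (S , S⊆V , ∣S∣ , a , b , a∈ , b∈ , a↛b) = ρ , record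
      { left = ρ-x ; right = ρ-y ; only = only-xy ; thin = ≤-reflexive ∣ρ∣ }
      where
      G-S = deleteVertices G S
      H = deleteVertices (deleteEdge G x y) S
      a→b : Reachable G-S a b
      a→b = decidable-stable (reachable? G-S a b) λ ¬r →
        proj₂ (proj₁ mkc) refl S (S⊆V , ∣S∣ , λ c → ¬r (c a∈ b∈))
      lift : (∀ {u v} → Adj G-S u v → SameEdge x y u v → Reachable H u v) →
             ∀ {u v} → Reachable G-S u v → Reachable H u v
      lift f ε = ε
      lift f (_◅_ {u} {v} (e , u∉ , v∉) r) with sameEdge? x y u v
      ... | yes same = f (e , u∉ , v∉) same ◅◅ lift f r
      ... | no diff  = ((e , diff) , u∉ , v∉) ◅ lift f r
      -- If S contained an end of `xy`, walks of `G - S` would never use `xy`, so the one from `a`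
      -- to `b` would survive in `H`.
      x∉S : x ∉ S
      x∉S x∈ = a↛b (lift (λ { (_ , u∉ , _) (inj₁ (refl , _)) → ⊥-elim (u∉ x∈)
                            ; (_ , _ , v∉) (inj₂ (_ , refl)) → ⊥-elim (v∉ x∈) }) a→b)
      y∉S : y ∉ S
      y∉S y∈ = a↛b (lift (λ { (_ , _ , v∉) (inj₁ (_ , refl)) → ⊥-elim (v∉ y∈)
                            ; (_ , u∉ , _) (inj₂ (refl , _)) → ⊥-elim (u∉ y∈) }) a→b)
      reverse : ∀ {u v} → Reachable H u v → Reachable H v u
      reverse ε       = ε
      reverse (e ◅ r) = reverse r ◅◅ (adj-sym H e ◅ ε)
      -- Such a walk would replace each use of `xy` on the walk from `a` to `b`.
      x↛y : ¬ Reachable H x y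
      x↛y r = a↛b (lift (λ { _ (inj₁ (refl , refl)) → r ; _ (inj₂ (refl , refl)) → reverse r }) a→b)
      side : ∀ {P Q : Set} → Dec P → Dec Q → Side
      side (yes _) _       = M
      side (no _)  (yes _) = L
      side (no _)  (no _)  = R
      side-L : ∀ {P Q : Set} (d : Dec P) (e : Dec Q) → side d e ≡ L → ¬ P × Q
      side-L (no ¬p) (yes q) _ = ¬p , q
      side-L (yes _) _       ()
      side-L (no _)  (no _)  ()
      side-R : ∀ {P Q : Set} (d : Dec P) (e : Dec Q) → side d e ≡ R → ¬ P × ¬ Q
      side-R (no ¬p) (no ¬q) _ = ¬p , ¬q
      side-R (yes _) _       ()
      side-R (no _)  (yes _) ()
      side-L⁺ : ∀ {P Q : Set} (d : Dec P) (e : Dec Q) → ¬ P → Q → side d e ≡ L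
      side-L⁺ (no _)  (yes _) ¬p q = refl
      side-L⁺ (yes p) _       ¬p q = ⊥-elim (¬p p)
      side-L⁺ (no _)  (no ¬q) ¬p q = ⊥-elim (¬q q)
      side-R⁺ : ∀ {P Q : Set} (d : Dec P) (e : Dec Q) → ¬ P → ¬ Q → side d e ≡ R
      side-R⁺ (no _)  (no _)  ¬p ¬q = refl
      side-R⁺ (yes p) _       ¬p ¬q = ⊥-elim (¬p p)
      side-R⁺ (no _)  (yes q) ¬p ¬q = ⊥-elim (¬q q)
      side-M : ∀ {P Q : Set} (d : Dec P) (e : Dec Q) → ⟦ side d e ∶ M ⟧ ≡ 𝟙 d
      side-M (yes _) _       = refl
      side-M (no _)  (yes _) = refl
      side-M (no _)  (no _)  = refl
      ρ : Label
      ρ v = side (v ∈? S) (reachable? H x v)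
      ρ-x : ρ x ≡ L
      ρ-x = side-L⁺ (x ∈? S) (reachable? H x x) x∉S ε
      ρ-y : ρ y ≡ R
      ρ-y = side-R⁺ (y ∈? S) (reachable? H x y) y∉S x↛y
      ρ-L : ∀ v → ρ v ≡ L → v ∉ S × Reachable H x v
      ρ-L v = side-L (v ∈? S) (reachable? H x v)
      ρ-R : ∀ v → ρ v ≡ R → v ∉ S × ¬ Reachable H x v
      ρ-R v = side-R (v ∈? S) (reachable? H x v)
      only-xy : ∀ {u v} → Adj G u v → ρ u ≡ L → ρ v ≡ R → u ≡ x × v ≡ y
      only-xy {u} {v} e p q with ρ-L u p | ρ-R v q | sameEdge? x y u v
      ... | _ | _ | yes (inj₁ uv) = uv
      ... | _ , x→y | _ | yes (inj₂ (refl , _)) = ⊥-elim (x↛y x→y)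
      ... | u∉ , x→u | v∉ , x↛v | no diff = ⊥-elim (x↛v (x→u ◅◅ (((e , diff) , u∉ , v∉) ◅ ε)))
      ∣ρ∣ : ∣ ρ ∣ᴹ ≡ κ
      ∣ρ∣ = trans (trans (sum-cong cell) (sym (∣∣≡sum S))) ∣S∣
        where
        cell : ∀ v → 𝟙 (v ∈? V G) * ⟦ ρ v ∶ M ⟧ ≡ 𝟙 (v ∈? S)
        cell v with v ∈? V G
        ... | yes _  = trans (+-identityʳ _) (side-M (v ∈? S) (reachable? H x v))
        ... | no v∉V = sym (𝟙-no (v ∈? S) (v∉V ∘ S⊆V))

    High : Fin N → Set
    High v = v ∈ V G × suc κ < degree G v

    HighEdge : Fin N → Fin N → Set
    HighEdge u v = Adj G u v × High u × High v

    highEdge-sym : ∀ {u v} → HighEdge u v → HighEdge v u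
    highEdge-sym (uv , u , v) = adj-sym G uv , v , u

    +-squeeze-≤ : ∀ {m n} → κ ≤ m → m + n ≤ κ + κ → n ≤ κ
    +-squeeze-≤ {n = n} κ≤m le = +-cancelˡ-≤ κ n κ (≤-trans (+-monoˡ-≤ n κ≤m) le)

    +-squeeze-< : ∀ {m n} → κ < m → m + n ≤ κ + κ → n < κ
    +-squeeze-< {n = n} κ<m le = +-cancelˡ-< κ n κ (≤-trans (+-monoˡ-≤ n κ<m) le)

    -- All edges leaving the corner of `y` run from `y` to `x` or `z`, so its middle has at least κ
    -- vertices and that of the opposite corner at most κ. Nothing leaves the opposite corner: an
    -- exit would be `xy` or `zy`, with `x` in `R` of τ or `z` in `R` of σ, and then `x` and `z`
    -- would coincide. Hence that corner is empty, and counting gives the inequality, strict because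
    -- of `y`.
    fork : ∀ {x y z σ τ} → High y → Adj G y x → Adj G y z → x ≢ z →
           Sep y x σ → Sep y z τ → NoRR τ σ × # R τ < # L σ
    fork {x} {y} {z} {σ} {τ} (y∈ , deg) yx yz x≢z s t = noRR , +-cancelʳ-< κ (# R τ) (# L σ) (begin-strict
      # R τ + κ                     ≤⟨ +-monoʳ-≤ (# R τ) (thick deg y∈ (adj⇒∈Vʳ yz) t) ⟩
      # R τ + ∣ τ ∣ᴹ                <⟨ shrink-< τ σ noRR y∈ (left t) (left s) ⟩
      # L σ + ∣ τ ᵒ ⊔ᴸ σ ᵒ ∣ᴹ       ≤⟨ +-monoʳ-≤ (# L σ) RR-thin ⟩
      # L σ + κ                     ∎)
      where
      open ≤-Reasoning
      LL-large : κ ≤ ∣ τ ⊔ᴸ σ ∣ᴹ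
      LL-large = two-exits⇒large (τ ⊔ᴸ σ) deg y∈ (cong₂ _⊔ˢ_ (left t) (left s))
        (adj⇒∈Vʳ yx) (⊔ˢ-R⁺ʳ (right s))
        λ e p q → [ (λ (u≡ , v≡) → u≡ , inj₂ v≡) , (λ (u≡ , v≡) → u≡ , inj₁ v≡) ]′ (⊔-only t s e p q)
      RR-thin : ∣ τ ᵒ ⊔ᴸ σ ᵒ ∣ᴹ ≤ κ
      RR-thin = +-squeeze-≤ LL-large (corners-κ t s)
      closed : ∀ {u v} → Adj G u v → (τ ᵒ ⊔ᴸ σ ᵒ) u ≡ L → (τ ᵒ ⊔ᴸ σ ᵒ) v ≡ R → ⊥
      closed {u} e p q with ⊔ˢ-L {opp (τ u)} p | ⊔-only (flip t) (flip s) e p q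
      ... | _ , σz | inj₁ (refl , refl) = x≢z (sym (proj₂ (only s yz (left s) (opp-L σz))))
      ... | τx , _ | inj₂ (refl , refl) = x≢z (proj₂ (only t yx (left t) (opp-L τx)))
      noRR : NoRR τ σ
      noRR v∈ τv σv = <⇒≱ (separates⇒large (τ ᵒ ⊔ᴸ σ ᵒ) closed v∈ (cong₂ _⊔ˢ_ (cong opp τv) (cong opp σv))
        y∈ (⊔ˢ-R⁺ʳ (cong opp (left s)))) RR-thin

    -- Orienting the edges of F towards a vertex w

    module Orientation {w : Fin N} (w∈ : w ∈ V G) (¬high : ¬ High w)
      (avoid : ∀ {a b} → HighEdge a b → ∃[ ρ ] Sep a b ρ × ρ w ≢ M) where

      Towards : Fin N → Fin N → Set
      Towards u v = HighEdge u v × ∃[ ρ ] Sep u v ρ × ρ w ≡ R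

      -- The edge `pw` would cross the separation of `pv`, hence be `pv` itself; but `v` is high and
      -- `w` is not.
      neighbour-is-sink : ∀ {p v} → Adj G w p → ¬ Towards p v
      neighbour-is-sink wp ((_ , _ , v-high) , ρ , s , ρw) =
        ¬high (subst High (sym (proj₂ (only s (adj-sym G wp) (left s) ρw))) v-high)

      -- By `fork`, no vertex, and so not `w`, lies on the far sides of two different edges out of
      -- `u`.
      towards-unique : ∀ {u v v′} → Towards u v → Towards u v′ → v ≡ v′
      towards-unique {v = v} {v′} ((uv , hu , _) , _ , s , p) ((uv′ , _) , _ , s′ , p′) =
        decidable-stable (v Fin.≟ v′) λ v≢v′ → proj₁ (fork hu uv uv′ v≢v′ s s′) w∈ p′ p

      orient : ∀ {u v} → HighEdge u v → Towards u v ⊎ Towards v u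
      orient e with avoid e
      ... | ρ , s , ρw≢M with ρ w in ρw
      ...   | L = inj₂ (highEdge-sym e , ρ ᵒ , flip s , cong opp ρw)
      ...   | M = ⊥-elim (ρw≢M refl)
      ...   | R = inj₁ (e , ρ , s , ρw)

      neighbours-apart : ∀ {p q} → Adj G w p → Adj G w q → Star HighEdge p q → p ≡ q
      neighbours-apart {p} {q} wp wq path with follow ε path
        where
        -- Invariant: a directed walk leads from the current vertex to the sink `p`. A backward edge
        -- prolongs it, and a forward edge must be its first step. At `q`, which is also a sink, the
        -- directed walk has to be trivial.
        follow : ∀ {u v} → Star Towards u p → Star HighEdge u v → Star Towards v p
        follow c ε = c
        follow c (e ◅ es) with orient e | c
        ... | inj₂ vu | _      = follow (vu ◅ c) es
        ... | inj₁ uv | ε      = ⊥-elim (neighbour-is-sink wp uv)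
        ... | inj₁ uv | o ◅ os with refl ← towards-unique uv o = follow os es
      ... | ε     = refl
      ... | o ◅ _ = ⊥-elim (neighbour-is-sink wq o)

  -- Uncrossing with a separation (D, T, C) whose side D is smallest

  module Uncrossing {N : ℕ} (G : Graph N) (κ : ℕ) (mkc : MinimallyKConnected (suc κ) G) where
    open MinimallyConnected G κ mkc public

    module Smallest {z y τ} (zy : HighEdge z y) (t : Sep z y τ)
      (minimal : ∀ {a b σ} → HighEdge a b → Sep a b σ → # L τ ≤ # L σ) where

      z∈ : z ∈ V G
      z∈ = proj₁ (proj₁ (proj₂ zy))

      y∈ : y ∈ V G
      y∈ = proj₁ (proj₂ (proj₂ zy))

      no-proper-part : ∀ {a b ρ} → HighEdge a b → Sep a b ρ → (∀ {v} → ρ v ≡ L → τ v ≡ L) →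
                       ∀ {w} → w ∈ V G → τ w ≡ L → ρ w ≢ L → ⊥
      no-proper-part {ρ = ρ} e s ρ⊆τ {w} w∈ τw ρw = <⇒≱ (∑ᵥ-mono-< (λ v _ → cell v) w∈ strict) (minimal e s)
        where
        cell : ∀ v → ⟦ ρ v ∶ L ⟧ ≤ ⟦ τ v ∶ L ⟧
        cell v with ρ v Fin.≟ L
        ... | no _  = z≤n
        ... | yes p = ≤-reflexive (sym (𝟙-yes (τ v Fin.≟ L) (ρ⊆τ p)))
        strict : ⟦ ρ w ∶ L ⟧ < ⟦ τ w ∶ L ⟧
        strict = subst₂ _<_ (sym (𝟙-no (ρ w Fin.≟ L) ρw)) (sym (𝟙-yes (τ w Fin.≟ L) τw)) (s≤s z≤n)

      minimalʳ : ∀ {a b σ} → HighEdge a b → Sep a b σ → # L τ ≤ # R σ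
      minimalʳ {σ = σ} e s = subst (# L τ ≤_) (#L-ᵒ σ) (minimal (highEdge-sym e) (flip s))

      -- If the corner were empty, `shrink-≤` would make the right side of σ smaller than D, against
      -- minimality applied to the flipped separation.
      RR-inhabited : ∀ {a b σ} → HighEdge a b → Sep a b σ → ∣ σ ᵒ ⊔ᴸ τ ᵒ ∣ᴹ < κ → ¬ NoRR σ τ
      RR-inhabited {σ = σ} e@(_ , (a∈ , deg) , b∈ , _) s thin-RR noRR = <⇒≱ #Rσ<#Lτ (minimalʳ e s)
        where
        open ≤-Reasoning
        #Rσ<#Lτ : # R σ < # L τ
        #Rσ<#Lτ = +-cancelʳ-< κ (# R σ) (# L τ) (begin-strict
          # R σ + κ                   ≤⟨ +-monoʳ-≤ (# R σ) (thick deg a∈ b∈ s) ⟩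
          # R σ + ∣ σ ∣ᴹ              ≤⟨ shrink-≤ σ τ noRR ⟩
          # L τ + ∣ σ ᵒ ⊔ᴸ τ ᵒ ∣ᴹ     <⟨ +-monoʳ-< (# L τ) thin-RR ⟩
          # L τ + κ                   ∎)

      -- As before, but the strict inequality now comes from the vertex `w` in the opposite corner
      -- instead of a thinner middle.
      RR-inhabited′ : ∀ {a b σ w} → HighEdge a b → Sep a b σ → w ∈ V G → σ w ≡ L → τ w ≡ L →
                      ∣ σ ᵒ ⊔ᴸ τ ᵒ ∣ᴹ ≤ κ → ¬ NoRR σ τ
      RR-inhabited′ {σ = σ} e@(_ , (a∈ , deg) , b∈ , _) s w∈ σw τw thin-RR noRR = <⇒≱ #Rσ<#Lτ (minimalʳ e s)
        where
        open ≤-Reasoning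
        #Rσ<#Lτ : # R σ < # L τ
        #Rσ<#Lτ = +-cancelʳ-< κ (# R σ) (# L τ) (begin-strict
          # R σ + κ                   ≤⟨ +-monoʳ-≤ (# R σ) (thick deg a∈ b∈ s) ⟩
          # R σ + ∣ σ ∣ᴹ              <⟨ shrink-< σ τ noRR w∈ σw τw ⟩
          # L τ + ∣ σ ᵒ ⊔ᴸ τ ᵒ ∣ᴹ     ≤⟨ +-monoʳ-≤ (# L τ) thin-RR ⟩
          # L τ + κ                   ∎)

      private
        RR : ∀ σ {v} → σ v ≡ R → τ v ≡ R → (σ ᵒ ⊔ᴸ τ ᵒ) v ≡ L
        RR σ p q = cong₂ _⊔ˢ_ (cong opp p) (cong opp q)

        ¬RRˡ : ∀ σ {v} → σ v ≡ L → (σ ᵒ ⊔ᴸ τ ᵒ) v ≡ R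
        ¬RRˡ σ p = cong (_⊔ˢ _) (cong opp p)

        ¬RRʳ : ∀ σ {v} → τ v ≡ L → (σ ᵒ ⊔ᴸ τ ᵒ) v ≡ R
        ¬RRʳ σ {v} q = ⊔ˢ-R⁺ʳ {opp (σ v)} (cong opp q)

        RR⁻ : ∀ σ {v} → (σ ᵒ ⊔ᴸ τ ᵒ) v ≡ L → σ v ≡ R × τ v ≡ R
        RR⁻ σ e with p , q ← ⊔ᴸ-L (σ ᵒ) (τ ᵒ) e = opp-L p , opp-L q

        differ : ∀ (ρ : Label) {u v s s′} → ρ u ≡ s → ρ v ≡ s′ → s ≢ s′ → u ≢ v
        differ ρ p q s≢s′ refl = s≢s′ (trans (sym p) q)

        R≢L : R ≢ L
        R≢L = L≢R ∘ sym

        exits : ∀ {a b σ} → Sep a b σ → ∀ {u v} → Adj G u v → (σ ᵒ ⊔ᴸ τ ᵒ) u ≡ L → (σ ᵒ ⊔ᴸ τ ᵒ) v ≡ R →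
                (u ≡ b × v ≡ a × τ b ≡ R) ⊎ (u ≡ y × v ≡ z × σ y ≡ R)
        exits {σ = σ} s e p q with RR⁻ σ p | ⊔-only (flip s) (flip t) e p q
        ... | _ , τb | inj₁ (refl , refl) = inj₁ (refl , refl , τb)
        ... | σy , _ | inj₂ (refl , refl) = inj₂ (refl , refl , σy)

      -- A second such neighbour of `z` would give, by `fork`, a separation whose far side is
      -- smaller than D.
      leaf : ∀ {b} → HighEdge z b → b ≡ y
      leaf {b} e@(zb , z-high , _) = decidable-stable (b Fin.≟ y) λ b≢y →
        let σ , s = critical zb in
        <⇒≱ (proj₂ (fork z-high (proj₁ zy) zb (b≢y ∘ sym) t s)) (minimalʳ e s)

      private
        -- The corner of `a` misses `z`, so its only exit is `ab`; a middle of at most κ vertices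
        -- would make it a side properly inside D. The opposite corner thus has a middle below κ and
        -- is inhabited. Its only possible exit is `yz`, so moving `z` into the middle cuts it off
        -- from `a` with at most κ vertices.
        end-inside-away : ∀ {a b σ} → HighEdge a b → Sep a b σ → τ a ≡ L → σ z ≢ L → ⊥
        end-inside-away {a} {b} {σ} e@(_ , (a∈ , _) , _) s τa σz = RR-inhabited e s RR-thin noRR
          where
          RR-thin : ∣ σ ᵒ ⊔ᴸ τ ᵒ ∣ᴹ < κ
          RR-thin = +-squeeze-< (≰⇒> λ small → no-proper-part e
            (record
              { left  = cong₂ _⊔ˢ_ (left s) τa
              ; right = cong (_⊔ˢ τ b) (right s)
              ; only  = λ uv p q → [ id , (λ { (refl , _) → ⊥-elim (σz (proj₁ (⊔ᴸ-L σ τ p))) }) ]′ (⊔-only s t uv p q)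
              ; thin  = small
              })
            (λ p → proj₂ (⊔ᴸ-L σ τ p)) z∈ (left t) (λ p → σz (proj₁ (⊔ᴸ-L σ τ p)))) (corners-κ s t)
          noRR : NoRR σ τ
          noRR v∈ σv τv = <⇒≱
            (separates⇒large (ρ ⟨ z ⟩) closed v∈ (trans (⟨⟩-≢ ρ (differ τ τv (left t) R≢L)) (RR σ σv τv))
              a∈ (trans (⟨⟩-≢ ρ λ { refl → σz (left s) }) (¬RRˡ σ (left s))))
            (≤-trans (⟨⟩-size ρ z) RR-thin)
            where
            ρ = σ ᵒ ⊔ᴸ τ ᵒ
            closed : ∀ {u v} → Adj G u v → (ρ ⟨ z ⟩) u ≡ L → (ρ ⟨ z ⟩) v ≡ R → ⊥
            closed uv p q with v≢z , q′ ← ⟨⟩-R ρ q | exits s uv (proj₂ (⟨⟩-L ρ p)) q′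
            ... | inj₁ (_ , _ , τb) with refl ← proj₁ (only t (proj₁ e) τa τb) = σz (left s)
            ... | inj₂ (_ , v≡z , _) = v≢z v≡z

        -- If the corner of `a` and `z` had a middle below κ, moving `a` into that middle would give
        -- `zy` a separation with a side properly inside D. So the opposite corner has a middle of
        -- at most κ vertices and is inhabited. An exit from it would force `a` and `z` to be equal,
        -- so it is closed, which is impossible.
        end-inside-near : ∀ {a b σ} → HighEdge a b → Sep a b σ → τ a ≡ L → a ≢ z → σ z ≡ L → ⊥
        end-inside-near {a} {b} {σ} e@(ab , (a∈ , _) , _) s τa a≢z σz = RR-inhabited′ e s z∈ σz (left t) RR-thin noRR
          where
          LL = σ ⊔ᴸ τ
          RR-thin : ∣ σ ᵒ ⊔ᴸ τ ᵒ ∣ᴹ ≤ κ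
          RR-thin = +-squeeze-≤ (≮⇒≥ λ small → no-proper-part zy
            (record
              { left  = trans (⟨⟩-≢ LL (a≢z ∘ sym)) (cong₂ _⊔ˢ_ σz (left t))
              ; right = trans (⟨⟩-≢ LL (differ τ (right t) τa R≢L)) (⊔ˢ-R⁺ʳ {σ y} (right t))
              ; only  = λ uv p q → let u≢a , p′ = ⟨⟩-L LL p in
                  [ (λ (u≡a , _) → ⊥-elim (u≢a u≡a)) , id ]′ (⊔-only s t uv p′ (proj₂ (⟨⟩-R LL q)))
              ; thin  = ≤-trans (⟨⟩-size LL a) small
              })
            (λ p → proj₂ (⊔ᴸ-L σ τ (proj₂ (⟨⟩-L LL p)))) a∈ τa (λ p → proj₁ (⟨⟩-L LL p) refl)) (corners-κ s t)
          noRR : NoRR σ τ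
          noRR v∈ σv τv = <⇒≱ (separates⇒large (σ ᵒ ⊔ᴸ τ ᵒ) closed v∈ (RR σ σv τv) z∈ (¬RRʳ σ (left t))) RR-thin
            where
            closed : ∀ {u v} → Adj G u v → (σ ᵒ ⊔ᴸ τ ᵒ) u ≡ L → (σ ᵒ ⊔ᴸ τ ᵒ) v ≡ R → ⊥
            closed uv p q with exits s uv p q
            ... | inj₁ (_ , _ , τb) = a≢z (proj₁ (only t ab τa τb))
            ... | inj₂ (_ , _ , σy) = a≢z (sym (proj₁ (only s (proj₁ zy) σz σy)))

      -- Together with `leaf` this shows that `zy` is the only edge of F with an end in D.
      end-inside : ∀ {a b} → HighEdge a b → τ a ≡ L → a ≡ z
      end-inside {a} e τa with critical (proj₁ e)
      ... | σ , s with σ z Fin.≟ L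
      ...   | no σz  = ⊥-elim (end-inside-away e s τa σz)
      ...   | yes σz = decidable-stable (a Fin.≟ z) λ a≢z → end-inside-near e s τa a≢z σz

      Avoidable : Fin N → Fin N → Set
      Avoidable a b = ∃[ ρ ] Sep a b ρ × (∀ {v} → v ∈ V G → τ v ≡ L → ρ v ≢ M)

      avoidable-sym : ∀ {a b} → Avoidable a b → Avoidable b a
      avoidable-sym (ρ , s , av) = ρ ᵒ , flip s , λ v∈ τv ρv → av v∈ τv (opp-M ρv)
        where
        opp-M : ∀ {s} → opp s ≡ M → s ≡ M
        opp-M {M} _ = refl
        opp-M {L} ()
        opp-M {R} ()

      private
        module _ {a b} (e : HighEdge a b) (τa : τ a ≢ L) where
          a∈ : a ∈ V G
          a∈ = proj₁ (proj₁ (proj₂ e))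

          a≢z : a ≢ z
          a≢z refl = τa (left t)

          -- The inhabited corner has at most the exits `ba` and `yz`. If one of them is missing,
          -- moving the outer end of the other into the middle cuts the corner off with at most κ
          -- vertices. If both start at the same vertex, `two-exits⇒large` applies. Otherwise moving
          -- `y` into the middle leaves `ba` as the only exit, and all of D lies on the right of
          -- this new separation.
          thin-corner : ∀ {σ} → Sep a b σ → ∣ σ ᵒ ⊔ᴸ τ ᵒ ∣ᴹ < κ → Avoidable a b
          thin-corner {σ} s RR-thin with σ y Fin.≟ R
          ... | no σy = ⊥-elim (RR-inhabited e s RR-thin λ v∈ σv τv → <⇒≱
            (separates⇒large (ρ ⟨ a ⟩) closed v∈ (trans (⟨⟩-≢ ρ (differ σ σv (left s) R≢L)) (RR σ σv τv))
              z∈ (trans (⟨⟩-≢ ρ (a≢z ∘ sym)) (¬RRʳ σ (left t))))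
            (≤-trans (⟨⟩-size ρ a) RR-thin))
            where
            ρ = σ ᵒ ⊔ᴸ τ ᵒ
            closed : ∀ {u v} → Adj G u v → (ρ ⟨ a ⟩) u ≡ L → (ρ ⟨ a ⟩) v ≡ R → ⊥
            closed uv p q with v≢a , q′ ← ⟨⟩-R ρ q | exits s uv (proj₂ (⟨⟩-L ρ p)) q′
            ... | inj₁ (_ , v≡a , _) = v≢a v≡a
            ... | inj₂ (_ , _ , σy′) = σy σy′
          ... | yes σy with τ b Fin.≟ R | b Fin.≟ y
          ...   | no τb | _ = ⊥-elim (<⇒≱
            (separates⇒large (ρ ⟨ z ⟩) closed y∈ (trans (⟨⟩-≢ ρ (differ τ (right t) (left t) R≢L)) (RR σ σy (right t)))
              a∈ (trans (⟨⟩-≢ ρ a≢z) (¬RRˡ σ (left s))))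
            (≤-trans (⟨⟩-size ρ z) RR-thin))
            where
            ρ = σ ᵒ ⊔ᴸ τ ᵒ
            closed : ∀ {u v} → Adj G u v → (ρ ⟨ z ⟩) u ≡ L → (ρ ⟨ z ⟩) v ≡ R → ⊥
            closed uv p q with v≢z , q′ ← ⟨⟩-R ρ q | exits s uv (proj₂ (⟨⟩-L ρ p)) q′
            ... | inj₁ (_ , _ , τb′) = τb τb′
            ... | inj₂ (_ , v≡z , _) = v≢z v≡z
          ...   | yes τb | yes refl = ⊥-elim (<⇒≱ RR-thin
            (two-exits⇒large (σ ᵒ ⊔ᴸ τ ᵒ) (proj₂ (proj₂ (proj₂ e))) y∈ (RR σ σy τb) a∈ (¬RRˡ σ (left s))
              λ uv p q → [ (λ (u≡ , v≡ , _) → u≡ , inj₁ v≡) , (λ (u≡ , v≡ , _) → u≡ , inj₂ v≡) ]′ (exits s uv p q)))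
          ...   | yes τb | no b≢y = avoidable-sym (ρ ⟨ y ⟩ , s′ , λ {v} v∈ τv ρv →
              R≢M (trans (sym (trans (⟨⟩-≢ ρ (differ τ τv (right t) L≢R)) (¬RRʳ σ τv))) ρv))
            where
            ρ = σ ᵒ ⊔ᴸ τ ᵒ
            s′ : Sep b a (ρ ⟨ y ⟩)
            s′ = record
              { left  = trans (⟨⟩-≢ ρ b≢y) (RR σ (right s) τb)
              ; right = trans (⟨⟩-≢ ρ (differ σ (left s) σy L≢R)) (¬RRˡ σ (left s))
              ; only  = λ uv p q → let u≢y , p′ = ⟨⟩-L ρ p in
                  [ (λ (u≡ , v≡ , _) → u≡ , v≡) , (λ (u≡y , _) → ⊥-elim (u≢y u≡y)) ]′
                  (exits s uv p′ (proj₂ (⟨⟩-R ρ q)))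
              ; thin  = ≤-trans (⟨⟩-size ρ y) RR-thin
              }

          -- If the corner `L`, `L` has a middle above κ, the opposite corner is thin. Otherwise the
          -- corner must have an exit, which can only be `zy`; it is then a left side for `zy` and
          -- by minimality all of D, so σ itself avoids D.
          meets-left : ∀ {σ v} → Sep a b σ → v ∈ V G → σ v ≡ L → τ v ≡ L → Avoidable a b
          meets-left {σ} {v} s v∈ σv τv with ∣ σ ⊔ᴸ τ ∣ᴹ ≤? κ | σ z Fin.≟ L
          ... | no large | _ = thin-corner s (+-squeeze-< (≰⇒> large) (corners-κ s t))
          ... | yes small | no σz = ⊥-elim (<⇒≱
            (separates⇒large (σ ⊔ᴸ τ) closed v∈ (cong₂ _⊔ˢ_ σv τv) (adj⇒∈Vʳ (proj₁ e)) (cong (_⊔ˢ τ b) (right s))) small)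
            where
            closed : ∀ {u v} → Adj G u v → (σ ⊔ᴸ τ) u ≡ L → (σ ⊔ᴸ τ) v ≡ R → ⊥
            closed uv p q with ⊔ᴸ-L σ τ p | ⊔-only s t uv p q
            ... | _ , τu | inj₁ (refl , _) = τa τu
            ... | σu , _ | inj₂ (refl , _) = σz σu
          ... | yes small | yes σz = σ , s , λ w∈ τw σw → no-proper-part zy s′ (λ p → proj₂ (⊔ᴸ-L σ τ p)) w∈ τw
              λ p → L≢M (trans (sym (proj₁ (⊔ᴸ-L σ τ p))) σw)
            where
            s′ : Sep z y (σ ⊔ᴸ τ)
            s′ = record
              { left  = cong₂ _⊔ˢ_ σz (left t)
              ; right = ⊔ˢ-R⁺ʳ {σ y} (right t)
              ; only  = λ uv p q →
                  [ (λ { (refl , _) → ⊥-elim (τa (proj₂ (⊔ᴸ-L σ τ p))) }) , id ]′ (⊔-only s t uv p q)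
              ; thin  = small
              }

      -- By `crossed-≤` the two middles have at most 3κ - 2|D| vertices together, which is less than
      -- 2κ.
      thin-corner-exists : κ < # L τ + # L τ → ∀ {a b σ} → Sep a b σ →
                           (∀ {v} → v ∈ V G → τ v ≡ L → σ v ≡ M) →
                           ∣ σ ᵒ ⊔ᴸ τ ᵒ ∣ᴹ < κ ⊎ ∣ σ ᵒ ᵒ ⊔ᴸ τ ᵒ ∣ᴹ < κ
      thin-corner-exists big {σ = σ} s D⊆M with ∣ σ ᵒ ⊔ᴸ τ ᵒ ∣ᴹ <? κ | ∣ σ ᵒ ᵒ ⊔ᴸ τ ᵒ ∣ᴹ <? κ
      ... | yes p | _     = inj₁ p
      ... | no _  | yes p = inj₂ p
      ... | no p  | no q  = ⊥-elim (<⇒≱ big (+-cancelˡ-≤ (κ + κ) _ _ (begin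
        κ + κ + (# L τ + # L τ)  ≤⟨ +-monoˡ-≤ _ (+-mono-≤ (≮⇒≥ p) (≮⇒≥ q)) ⟩
        ∣ σ ᵒ ⊔ᴸ τ ᵒ ∣ᴹ + ∣ σ ᵒ ᵒ ⊔ᴸ τ ᵒ ∣ᴹ + (# L τ + # L τ)  ≤⟨ crossed-≤ σ τ D⊆M ⟩
        ∣ σ ∣ᴹ + ∣ σ ∣ᴹ + ∣ τ ∣ᴹ  ≤⟨ +-mono-≤ (+-mono-≤ (thin s) (thin s)) (thin t) ⟩
        κ + κ + κ                ∎)))
        where open ≤-Reasoning

      avoidable-inside : ∀ {a b} → HighEdge a b → τ a ≡ L → Avoidable a b
      avoidable-inside {b = b} e τa = at-zy (end-inside e τa) (leaf (subst (λ u → HighEdge u b) (end-inside e τa) e))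
        where
        at-zy : ∀ {a b} → a ≡ z → b ≡ y → Avoidable a b
        at-zy refl refl = τ , t , λ _ τv τv′ → L≢M (trans (sym τv) τv′)

      avoidable : κ < # L τ + # L τ → ∀ {a b} → HighEdge a b → Avoidable a b
      avoidable big {a} {b} e with τ a Fin.≟ L | τ b Fin.≟ L
      ... | yes τa | _      = avoidable-inside e τa
      ... | no _   | yes τb = avoidable-sym (avoidable-inside (highEdge-sym e) τb)
      ... | no τa  | no τb = avoid (critical (proj₁ e))
        where
        avoid : (∃[ σ ] Sep a b σ) → Avoidable a b
        avoid (σ , s) with Fin.any? (λ v → v ∈? V G ×-dec τ v Fin.≟ L ×-dec ¬? (σ v Fin.≟ M))
        ... | no none = [ thin-corner e τa s , avoidable-sym ∘ thin-corner (highEdge-sym e) τb (flip s) ]′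
          (thin-corner-exists big s λ {v} v∈ τv → decidable-stable (σ v Fin.≟ M) λ σv → none (v , v∈ , τv , σv))
        ... | yes (v , v∈ , τv , σv) = touching (σ v) refl σv
          where
          touching : ∀ x → σ v ≡ x → x ≢ M → Avoidable a b
          touching L p _ = meets-left e τa s v∈ p τv
          touching M _ q = ⊥-elim (q refl)
          touching R p _ = avoidable-sym (meets-left (highEdge-sym e) τb (flip s) v∈ (cong opp p) τv)

  -- Components and forests

  x∈p─q⇒x∉q : ∀ {n} (p q : Subset n) {x} → x ∈ p ─ q → x ∉ q
  x∈p─q⇒x∉q (_ ∷ p) (_      ∷ q) (there i) (there j) = x∈p─q⇒x∉q p q i j
  x∈p─q⇒x∉q (_ ∷ p) (inside ∷ q) ()        here

  AllPairs-lookup : ∀ {a r} {A : Set a} {_~_ : Rel A r} {xs : List A} → Symmetric _~_ → AllPairs _~_ xs →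
                    ∀ {i j} → i ≢ j → List.lookup xs i ~ List.lookup xs j
  AllPairs-lookup s (p ∷ ps) {zero}  {zero}  i≢j = ⊥-elim (i≢j refl)
  AllPairs-lookup s (p ∷ ps) {zero}  {suc j} i≢j = All.lookup p (∈-lookup j)
  AllPairs-lookup s (p ∷ ps) {suc i} {zero}  i≢j = s (All.lookup p (∈-lookup i))
  AllPairs-lookup s (p ∷ ps) {suc i} {suc j} i≢j = AllPairs-lookup s ps (i≢j ∘ cong suc)

  AllPairs-with-All : ∀ {a p r} {A : Set a} {P : A → Set p} {_~_ : Rel A r} {xs : List A} →
                      AllPairs (λ x y → P x → P y → x ~ y) xs → All P xs → AllPairs _~_ xs
  AllPairs-with-All []       []         = []
  AllPairs-with-All (r ∷ rs) (px ∷ pxs) =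
    All.zipWith (λ (f , py) → f px py) (r , pxs) ∷ AllPairs-with-All rs pxs

  -- Pigeonhole: two entries of `xs` sent to the same position of `ys` would be related to each
  -- other through it.
  length-≤-by-cover : ∀ {a r} {A : Set a} {_~_ : Rel A r} {xs ys : List A} → Symmetric _~_ → Transitive _~_ →
                      AllPairs (λ x y → ¬ x ~ y) xs → All (λ x → Any (x ~_) ys) xs → length xs ≤ length ys
  length-≤-by-cover {_~_ = _~_} {xs} {ys} ~-sym ~-trans apart cover = Fin.injective⇒≤ {f = place} λ {i} {j} eq →
    decidable-stable (i Fin.≟ j) λ i≢j → AllPairs-lookup (λ ¬r → ¬r ∘ ~-sym) apart i≢j
      (~-trans (subst (λ n → List.lookup xs i ~ List.lookup ys n) eq (related i)) (~-sym (related j)))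
    where
    hit : ∀ i → Any (List.lookup xs i ~_) ys
    hit i = All.lookup cover (∈-lookup i)
    place : Fin (length xs) → Fin (length ys)
    place i = Any.index (hit i)
    related : ∀ i → List.lookup xs i ~ List.lookup ys (place i)
    related i = Any.lookup-index (hit i)

  module Components {N : ℕ} (H : Graph N) where

    reachable-sym : Symmetric (Reachable H)
    reachable-sym = Star.reverse (adj-sym H)

    private
      vertices components : List (Fin N)
      vertices   = filter (_∈? V H) (allFin N)
      components = deduplicate (reachable? H) vertices

      apart : ∀ xs → AllPairs (λ u v → ¬ Reachable H u v) (deduplicate (reachable? H) xs)
      apart []       = []
      apart (x ∷ xs) = All.all-filter _ (deduplicate (reachable? H) xs) ∷ AllPairs.filter⁺ _ (apart xs)

      covered : ∀ {v} → v ∈ V H → Any (Reachable H v) components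
      covered {v} v∈ = Any.deduplicate⁺ (reachable? H) (λ yx vx → vx ◅◅ reachable-sym yx)
        (Any.map (λ { refl → ε }) (∈-filter⁺ (_∈? V H) (∈-allFin v) v∈))

    module _ {P : Fin N → Set} (P? : ∀ v → Dec (P v)) where

      independent⇒≤ : (∀ {v} → P v → v ∈ V H) → (∀ {u v} → P u → P v → Reachable H u v → u ≡ v) →
                      sum (λ v → 𝟙 (P? v)) ≤ componentCount H
      independent⇒≤ P⊆V indep = subst (_≤ componentCount H) (length-filter-tabulate P? id)
        (length-≤-by-cover reachable-sym _◅◅_
          (AllPairs-with-All (AllPairs.filter⁺ P? (AllPairs.tabulate⁺ λ u≢v pu pv r → u≢v (indep pu pv r))) P-all)
          (All.map (covered ∘ P⊆V) P-all))
        where P-all = All.all-filter P? (allFin N)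

      dominating⇒≥ : (∀ {v} → v ∈ V H → ∃[ u ] P u × Reachable H v u) →
                     componentCount H ≤ sum (λ v → 𝟙 (P? v))
      dominating⇒≥ dom = subst (componentCount H ≤_) (length-filter-tabulate P? id)
        (length-≤-by-cover reachable-sym _◅◅_ (apart vertices)
          (All.map (λ v∈ → let u , pu , r = dom v∈ in Any.map (λ { refl → r }) (∈-filter⁺ P? (∈-allFin u) pu))
                   (All.deduplicate⁺ (reachable? H) (All.all-filter (_∈? V H) (allFin N)))))

  -- Edge counts and forests

  module _ {N : ℕ} where

    adjacencies : Graph N → ℕ
    adjacencies H = sum λ u → sum λ v → 𝟙 (adj? H u v)

    2*size : ∀ H → 2 * size H ≡ adjacencies H
    2*size H = trans (cong (2 *_) (length-filter-product _ id)) (handshake (adj? H) (adj-sym H) (irrefl H))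

    size-deleteEdge : ∀ H {x y} → Adj H x y → size H ≡ suc (size (deleteEdge H x y))
    size-deleteEdge H {x} {y} xy = *-cancelˡ-≡ (size H) (suc (size H-e)) 2 (begin
      2 * size H                         ≡⟨ 2*size H ⟩
      adjacencies H                      ≡⟨ sum-cong (λ u → sum-cong (cell u)) ⟩
      sum (λ u → sum λ v → 𝟙 (adj? H-e u v) + (δ x y u v + δ y x u v))
        ≡⟨ sum-sum-+ _ _ ⟩
      adjacencies H-e + sum (λ u → sum λ v → δ x y u v + δ y x u v)
        ≡⟨ cong (adjacencies H-e +_) (trans (sum-sum-+ _ _) (cong₂ _+_ (sum-sum-δ x y) (sum-sum-δ y x))) ⟩
      adjacencies H-e + 2                ≡⟨ cong (_+ 2) (2*size H-e) ⟨
      2 * size H-e + 2                   ≡⟨ +-comm _ 2 ⟩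
      2 + 2 * size H-e                   ≡⟨ *-suc 2 (size H-e) ⟨
      2 * suc (size H-e)                 ∎)
      where
      open ≡-Reasoning
      H-e = deleteEdge H x y
      δ : Fin N → Fin N → Fin N → Fin N → ℕ
      δ a b u v = 𝟙 (u Fin.≟ a ×-dec v Fin.≟ b)
      sum-sum-δ : ∀ a b → sum (λ u → sum (δ a b u)) ≡ 1
      sum-sum-δ a b = trans (sum-cong row) (sum-δ a)
        where
        row : ∀ u → sum (δ a b u) ≡ 𝟙 (u Fin.≟ a)
        row u with u Fin.≟ a
        ... | yes _ = sum-δ b
        ... | no _  = sum-zero λ _ → refl
      x≢y : x ≢ y
      x≢y refl = irrefl H xy
      cell : ∀ u v → 𝟙 (adj? H u v) ≡ 𝟙 (adj? H-e u v) + (δ x y u v + δ y x u v)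
      cell u v with sameEdge? x y u v
      ... | no diff = trans
        (𝟙-cong (adj? H u v) (adj? H-e u v) (_, diff) proj₁)
        (sym (trans (cong (𝟙 (adj? H-e u v) +_) (cong₂ _+_ (𝟙-no (u Fin.≟ x ×-dec v Fin.≟ y) (diff ∘ inj₁))
                                                           (𝟙-no (u Fin.≟ y ×-dec v Fin.≟ x) (diff ∘ inj₂))))
                    (+-identityʳ _)))
      ... | yes same@(inj₁ (refl , refl)) = trans (𝟙-yes (adj? H x y) xy) (sym (cong₂ _+_
        (𝟙-no (adj? H-e x y) (λ (_ , diff) → diff same))
        (cong₂ _+_ (𝟙-yes (x Fin.≟ x ×-dec y Fin.≟ y) (refl , refl)) (𝟙-no (x Fin.≟ y ×-dec y Fin.≟ x) (x≢y ∘ proj₁)))))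
      ... | yes same@(inj₂ (refl , refl)) = trans (𝟙-yes (adj? H y x) (adj-sym H xy)) (sym (cong₂ _+_
        (𝟙-no (adj? H-e y x) (λ (_ , diff) → diff same))
        (cong₂ _+_ (𝟙-no (y Fin.≟ x ×-dec x Fin.≟ y) (x≢y ∘ proj₂)) (𝟙-yes (y Fin.≟ y ×-dec x Fin.≟ x) (refl , refl)))))

    -- A rank on oriented edges that drops along every path rules out cycles, and
    -- its minima are attained at leaves.
    Descending : (Fin N → Fin N → ℕ) → Graph N → Set
    Descending g H = ∀ {x y z} → Adj H x y → Adj H y z → x ≢ z → g y z < g x y

    leaf-exists : ∀ {g} H → Descending g H → ∀ {x y} → Adj H x y →
                  ∃[ x′ ] ∃[ y′ ] Adj H x′ y′ × (∀ {z} → Adj H y′ z → z ≡ x′)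
    leaf-exists {g} H desc xy = search xy (<-wellFounded _)
      where
      search : ∀ {x y} → Adj H x y → Acc _<_ (g x y) → ∃[ x′ ] ∃[ y′ ] Adj H x′ y′ × (∀ {z} → Adj H y′ z → z ≡ x′)
      search {x} {y} xy (acc rs) with Fin.any? (λ z → adj? H y z ×-dec ¬? (z Fin.≟ x))
      ... | yes (z , yz , z≢x) = search yz (rs (desc xy yz (z≢x ∘ sym)))
      ... | no none = x , y , xy , λ {z} yz → decidable-stable (z Fin.≟ x) λ z≢x → none (z , yz , z≢x)

    -- One vertex from each component, chosen freely. Unlike the deduplicated list, such a set is
    -- easily updated when an edge is restored.
    record Transversal (H : Graph N) (T : Subset N) : Set where
      field
        inside-V    : T ⊆ V H
        independent : ∀ {u v} → u ∈ T → v ∈ T → Reachable H u v → u ≡ v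
        dominating  : ∀ {v} → v ∈ V H → ∃[ u ] u ∈ T × Reachable H v u

    transversal-size : ∀ {H T} → Transversal H T → ∣ T ∣ ≡ componentCount H
    transversal-size {H} {T} t = trans (∣∣≡sum T) (≤-antisym
      (independent⇒≤ (_∈? T) inside-V independent) (dominating⇒≥ (_∈? T) dominating))
      where
      open Components H
      open Transversal t

    module _ (H : Graph N) {x y : Fin N} (xy : Adj H x y) (leaf : ∀ {z} → Adj H y z → z ≡ x) where
      private
        H-e = deleteEdge H x y

        x≢y : x ≢ y
        x≢y refl = irrefl H xy

        isolated : ∀ {v} → Reachable H-e y v → v ≡ y
        isolated ε = refl
        isolated ((yz , diff) ◅ _) = ⊥-elim (diff (inj₂ (refl , leaf yz)))

        isolated′ : ∀ {v} → Reachable H-e v y → v ≡ y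
        isolated′ r = isolated (Components.reachable-sym H-e r)

        -- A visit to the leaf `y` comes from `x` and returns to `x`, so it can be cut out.
        bypass : ∀ {u v} → v ≢ y → u ≢ y → Reachable H u v → Reachable H-e u v
        bypass-leaf : ∀ {v} → v ≢ y → Reachable H y v → Reachable H-e x v
        bypass v≢y u≢y ε = ε
        bypass v≢y u≢y (_◅_ {j = w} uw r) with w Fin.≟ y
        ... | yes refl rewrite leaf (adj-sym H uw) = bypass-leaf v≢y r
        ... | no w≢y = (uw , λ { (inj₁ (_ , w≡y)) → w≢y w≡y ; (inj₂ (u≡y , _)) → u≢y u≡y }) ◅ bypass v≢y w≢y r
        bypass-leaf v≢y ε = ⊥-elim (v≢y refl)
        bypass-leaf v≢y (yz ◅ r) with refl ← leaf yz = bypass v≢y x≢y r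

      -- Without `xy` the leaf `y` is a component of its own and so belongs to `T`; once the edge is
      -- back, the representative of `x` serves `y` as well.
      restore-leaf : ∀ {T} → Transversal H-e T → Transversal H (T - y) × ∣ T ∣ ≡ suc ∣ T - y ∣
      restore-leaf {T} t = record
        { inside-V = inside-V ∘ shrink
        ; independent = λ u∈ v∈ r → independent (shrink u∈) (shrink v∈) (bypass (≢y v∈) (≢y u∈) r)
        ; dominating = dom
        } , trans (∣∣≡sum T) (trans (sum-cong cell) (trans (sum-+ _ _) (cong₂ _+_ (sum-δ y) (sym (∣∣≡sum (T - y))))))
        where
        open Transversal t
        shrink : T - y ⊆ T
        shrink = p─q⊆p T ⁅ y ⁆
        ≢y : ∀ {v} → v ∈ T - y → v ≢ y
        ≢y v∈ refl = x∈p─q⇒x∉q T ⁅ y ⁆ v∈ (x∈⁅x⁆ y)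
        y∈T : y ∈ T
        y∈T with u , u∈ , r ← dominating (adj⇒∈V H (adj-sym H xy)) with refl ← isolated r = u∈
        lift : ∀ {u v} → Reachable H-e u v → Reachable H u v
        lift = Star.map proj₁
        dom′ : ∀ {v} → v ∈ V H → v ≢ y → ∃[ u ] u ∈ T - y × Reachable H v u
        dom′ v∈ v≢y with u , u∈ , r ← dominating v∈ =
          u , x∈p∧x≢y⇒x∈p-y u∈ (λ { refl → v≢y (isolated′ r) }) , lift r
        dom : ∀ {v} → v ∈ V H → ∃[ u ] u ∈ T - y × Reachable H v u
        dom {v} v∈ with v Fin.≟ y
        ... | no v≢y = dom′ v∈ v≢y
        ... | yes refl with u , u∈ , r ← dom′ (adj⇒∈V H xy) x≢y = u , u∈ , adj-sym H xy ◅ r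
        cell : ∀ i → 𝟙 (i ∈? T) ≡ 𝟙 (i Fin.≟ y) + 𝟙 (i ∈? T - y)
        cell i with i Fin.≟ y
        ... | yes refl = trans (𝟙-yes (y ∈? T) y∈T) (cong suc (sym (𝟙-no (y ∈? T - y) λ y∈ → ≢y y∈ refl)))
        ... | no i≢y   = 𝟙-cong (i ∈? T) (i ∈? T - y) (λ i∈ → x∈p∧x≢y⇒x∈p-y i∈ i≢y) shrink

    -- Induction on the number of edges: each leaf edge removed adds one component. The rank still
    -- descends, because deletion creates no adjacency.
    forest-transversal : ∀ {g} n H → size H ≡ n → Descending g H →
                         ∃[ T ] Transversal H T × ∣ T ∣ + size H ≡ order H
    forest-transversal {g} n H #e desc with Fin.any? (λ x → Fin.any? λ y → adj? H x y)
    ... | no none = V H , record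
      { inside-V = id
      ; independent = λ { _ _ ε → refl ; _ _ (e ◅ _) → ⊥-elim (none (_ , _ , e)) }
      ; dominating = λ v∈ → _ , v∈ , ε
      } , trans (cong (order H +_) size≡0) (+-identityʳ _)
      where
      size≡0 : size H ≡ 0
      size≡0 = m+n≡0⇒m≡0 (size H) (trans (2*size H)
        (sum-zero λ u → sum-zero λ v → 𝟙-no (adj? H u v) λ e → none (u , v , e)))
    ... | yes (_ , _ , e) with leaf-exists H desc e
    ...   | x , y , xy , leaf = step n #e
      where
      H-e = deleteEdge H x y
      step : ∀ n → size H ≡ n → ∃[ T ] Transversal H T × ∣ T ∣ + size H ≡ order H
      step zero    eq with () ← trans (sym eq) (size-deleteEdge H xy)
      step (suc n) eq with T , t , count ← forest-transversal n H-e
                             (suc-injective (trans (sym (size-deleteEdge H xy)) eq))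
                             (λ (e , _) (e′ , _) → desc e e′)
                      with t′ , ∣T∣ ← restore-leaf H xy leaf t =
        T - y , t′ , (begin
          ∣ T - y ∣ + size H             ≡⟨ cong (∣ T - y ∣ +_) (size-deleteEdge H xy) ⟩
          ∣ T - y ∣ + suc (size H-e)     ≡⟨ +-suc _ _ ⟩
          suc ∣ T - y ∣ + size H-e       ≡⟨ cong (_+ size H-e) ∣T∣ ⟨
          ∣ T ∣ + size H-e               ≡⟨ count ⟩
          order H                        ∎)
        where open ≡-Reasoning

    forest-count : ∀ {g} H → Descending g H → componentCount H + size H ≡ order H
    forest-count H desc with T , t , count ← forest-transversal (size H) H refl desc =
      trans (cong (_+ size H) (sym (transversal-size t))) count

  -- Counting edges

  sum-sum-mono : ∀ {m n} {f g : Fin m → Fin n → ℕ} → (∀ i j → f i j ≤ g i j) →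
                 sum (λ i → sum (f i)) ≤ sum (λ i → sum (g i))
  sum-sum-mono h = sum-mono λ i → sum-mono (h i)

  sum-δ-* : ∀ {n} (f : Fin n → ℕ) i → sum (λ j → 𝟙 (j Fin.≟ i) * f j) ≡ f i
  sum-δ-* f i = trans (sum-cong cell) (trans (sum-*ˡ (f i) _) (trans (cong (f i *_) (sum-δ i)) (*-identityʳ (f i))))
    where
    cell : ∀ j → 𝟙 (j Fin.≟ i) * f j ≡ f i * 𝟙 (j Fin.≟ i)
    cell j with j Fin.≟ i
    ... | yes refl = *-comm 1 (f j)
    ... | no _     = sym (*-zeroʳ (f i))

  module SymmetricMatrix {n} (m : Fin n → Fin n → ℕ) (m-sym : ∀ i j → m i j ≡ m j i)
                         (m≤1 : ∀ i j → m i j ≤ 1) (m-diag : ∀ i → m i i ≡ 0) where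

    private
      row-sum : ∀ q → sum (λ i → sum λ j → 𝟙 (i Fin.≟ q) * m i j) ≡ sum (m q)
      row-sum q = trans (sum-cong λ i → sum-*ˡ (𝟙 (i Fin.≟ q)) (m i)) (sum-δ-* (λ i → sum (m i)) q)

      column-sum : ∀ q → sum (λ i → sum λ j → 𝟙 (j Fin.≟ q) * m i j) ≡ sum (m q)
      column-sum q = trans (sum-cong λ i → sum-δ-* (m i) q) (sum-cong λ i → m-sym i q)

      cross : Fin n → Fin n → Fin n → ℕ
      cross q i j = 𝟙 (i Fin.≟ q) * m i j + 𝟙 (j Fin.≟ q) * m i j

      cross-sum : ∀ q → sum (λ i → sum (cross q i)) ≡ 2 * sum (m q)
      cross-sum q = trans (sum-sum-+ _ _) (cong₂ _+_ (row-sum q) (trans (column-sum q) (sym (+-identityʳ _))))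

    -- The row and the column of `q` have equal sums and share only a zero on the diagonal.
    one-row : ∀ q → 2 * sum (m q) ≤ sum (λ i → sum (m i))
    one-row q = subst (_≤ _) (cross-sum q) (sum-sum-mono cell)
      where
      cell : ∀ i j → cross q i j ≤ m i j
      cell i j with i Fin.≟ q | j Fin.≟ q
      ... | yes refl | yes refl rewrite m-diag j = z≤n
      ... | yes _    | no _  = ≤-reflexive (trans (+-identityʳ _) (*-identityˡ _))
      ... | no _     | yes _ = ≤-reflexive (*-identityˡ _)
      ... | no _     | no _  = z≤n

    -- Apart from the diagonal, the two crosses overlap only in the entries at `p`, `q` and `q`,
    -- `p`, each at most 1; this is the 2.
    two-rows : ∀ {p q} → p ≢ q → 2 * (sum (m p) + sum (m q)) ≤ sum (λ i → sum (m i)) + 2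
    two-rows {p} {q} p≢q = begin
      2 * (sum (m p) + sum (m q))                               ≡⟨ *-distribˡ-+ 2 (sum (m p)) _ ⟩
      2 * sum (m p) + 2 * sum (m q)                             ≡⟨ cong₂ _+_ (cross-sum p) (cross-sum q) ⟨
      sum (λ i → sum (cross p i)) + sum (λ i → sum (cross q i)) ≡⟨ sum-sum-+ _ _ ⟨
      sum (λ i → sum λ j → cross p i j + cross q i j)           ≤⟨ sum-sum-mono cell ⟩
      sum (λ i → sum λ j → m i j + (δ p q i j + δ q p i j))     ≡⟨ sum-sum-+ _ _ ⟩
      total + sum (λ i → sum λ j → δ p q i j + δ q p i j)       ≡⟨ cong (total +_) (sum-sum-+ _ _) ⟩
      total + (sum (λ i → sum (δ p q i)) + sum (λ i → sum (δ q p i))) ≡⟨ cong (total +_) (cong₂ _+_ (δ-sum p q) (δ-sum q p)) ⟩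
      total + 2                                                 ∎
      where
      open ≤-Reasoning
      total = sum (λ i → sum (m i))
      δ : Fin n → Fin n → Fin n → Fin n → ℕ
      δ a b i j = 𝟙 (i Fin.≟ a) * 𝟙 (j Fin.≟ b)
      δ-sum : ∀ a b → sum (λ i → sum (δ a b i)) ≡ 1
      δ-sum a b = trans (sum-cong λ i → sum-*ˡ (𝟙 (i Fin.≟ a)) _) (trans (sum-δ-* (λ _ → sum λ j → 𝟙 (j Fin.≟ b)) a) (sum-δ b))
      cell : ∀ i j → cross p i j + cross q i j ≤ m i j + (δ p q i j + δ q p i j)
      cell i j with i Fin.≟ p | i Fin.≟ q | j Fin.≟ p | j Fin.≟ q
      ... | yes refl | yes refl | _        | _        = ⊥-elim (p≢q refl)
      ... | _        | _        | yes refl | yes refl = ⊥-elim (p≢q refl)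
      ... | yes refl | no _     | yes refl | no _     rewrite m-diag i = z≤n
      ... | no _     | yes refl | no _     | yes refl rewrite m-diag i = z≤n
      ... | yes _    | no _     | no _     | yes _    = doubled (m i j) (m≤1 i j)
        where
        doubled : ∀ x → x ≤ 1 → x + 0 + 0 + (x + 0) ≤ x + 1
        doubled .0 z≤n       = z≤n
        doubled .1 (s≤s z≤n) = ≤-refl
      ... | no _     | yes _    | yes _    | no _     = doubled (m i j) (m≤1 i j)
        where
        doubled : ∀ x → x ≤ 1 → x + 0 + (x + 0 + 0) ≤ x + 1
        doubled .0 z≤n       = z≤n
        doubled .1 (s≤s z≤n) = ≤-refl
      ... | yes _    | no _     | no _     | no _     = ≤-reflexive (solve 1 (λ x → x :+ con 0 :+ con 0 :+ con 0 := x :+ con 0) refl (m i j))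
        where open +-*-Solver
      ... | no _     | yes _    | no _     | no _     = ≤-reflexive (solve 1 (λ x → x :+ con 0 :+ con 0 := x :+ con 0) refl (m i j))
        where open +-*-Solver
      ... | no _     | no _     | yes _    | no _     = ≤-reflexive (solve 1 (λ x → x :+ con 0 :+ con 0 := x :+ con 0) refl (m i j))
        where open +-*-Solver
      ... | no _     | no _     | no _     | yes _    = ≤-reflexive refl
      ... | no _     | no _     | no _     | no _     = z≤n

  -- The equation between edges, vertices and components

  module Counting {N : ℕ} (G : Graph N) (κ : ℕ) (mkc : MinimallyKConnected (suc κ) G) where
    open Uncrossing G κ mkc

    k : ℕ
    k = suc κ

    Vₖ : Subset N
    Vₖ = verticesOfDegree k G

    F : Graph N
    F = deleteVertices G Vₖ

    ∣Eₖ∣ c-F : ℕ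
    ∣Eₖ∣ = length (edgesWithin G Vₖ)
    c-F = componentCount F

    ∈Vₖ⁻ : ∀ {v} → v ∈ Vₖ → v ∈ V G × degree G v ≡ k
    ∈Vₖ⁻ = ∈-tabulate⁻ λ v → v ∈? V G ×-dec degree G v ≟ k

    ∈Vₖ⁺ : ∀ {v} → v ∈ V G → degree G v ≡ k → v ∈ Vₖ
    ∈Vₖ⁺ v∈ d = ∈-tabulate⁺ (λ v → v ∈? V G ×-dec degree G v ≟ k) (v∈ , d)

    high : ∀ {v} → v ∈ V G → v ∉ Vₖ → High v
    high v∈ v∉ = v∈ , ≤∧≢⇒< (k≤degree v∈) (v∉ ∘ ∈Vₖ⁺ v∈ ∘ sym)

    ¬high : ∀ {v} → v ∈ Vₖ → ¬ High v
    ¬high v∈ (_ , k<d) = <⇒≢ k<d (sym (proj₂ (∈Vₖ⁻ v∈)))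

    F⇒highEdge : ∀ {u v} → Adj F u v → HighEdge u v
    F⇒highEdge (uv , u∉ , v∉) = uv , high (adj⇒∈V G uv) u∉ , high (adj⇒∈Vʳ uv) v∉

    F-descending : ∃[ g ] Descending g F
    F-descending = (λ x y → far (adj? G x y)) , λ {x} {y} {z} xy yz x≢z → descend xy yz x≢z (adj? G x y) (adj? G y z)
      where
      -- The rank must be defined on all pairs, while `critical` needs an adjacency; 0 is a dummy
      -- value. Using the proof inside `adj?` fixes one separation per oriented edge.
      far : ∀ {x y} → Dec (Adj G x y) → ℕ
      far (yes e) = # R (proj₁ (critical e))
      far (no _)  = 0
      descend : ∀ {x y z} → Adj F x y → Adj F y z → x ≢ z →
                (d : Dec (Adj G x y)) (e : Dec (Adj G y z)) → far e < far d
      descend xy yz x≢z (no ¬e) _       = ⊥-elim (¬e (proj₁ xy))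
      descend xy yz x≢z (yes _) (no ¬e) = ⊥-elim (¬e (proj₁ yz))
      -- The separation of `xy` is flipped so that `y` is on the left of both, as `fork` requires.
      descend {x} {y} {z} xy yz x≢z (yes d) (yes e) = subst (# R (proj₁ (critical e)) <_) (#L-ᵒ (proj₁ (critical d)))
        (proj₂ (fork (proj₁ (proj₂ (F⇒highEdge yz))) (adj-sym G d) e x≢z
                     (flip (proj₂ (critical d))) (proj₂ (critical e))))

    inVₖ : Fin N → ℕ
    inVₖ v = 𝟙 (v ∈? Vₖ)

    E : Fin N → Fin N → ℕ
    E u v = 𝟙 (adj? G u v ×-dec u ∈? Vₖ ×-dec v ∈? Vₖ)

    2*∣Eₖ∣ : 2 * ∣Eₖ∣ ≡ sum λ u → sum (E u)
    2*∣Eₖ∣ = begin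
      2 * ∣Eₖ∣                                    ≡⟨ cong (2 *_) (trans (length-filter-filter edge? within? (cartesianProduct (allFin N) (allFin N)))
                                                             (length-filter-product (λ p → edge? p ×-dec within? p) id)) ⟩
      2 * sum (λ u → sum λ v → 𝟙 ((u Fin.<? v ×-dec adj? G u v) ×-dec (u ∈? Vₖ ×-dec v ∈? Vₖ)))
        ≡⟨ cong (2 *_) (sum-cong λ u → sum-cong λ v → 𝟙-cong
             ((u Fin.<? v ×-dec adj? G u v) ×-dec (u ∈? Vₖ ×-dec v ∈? Vₖ)) (u Fin.<? v ×-dec E? u v)
             (λ ((a , b) , c) → a , b , c) (λ (a , b , c) → (a , b) , c)) ⟩
      2 * sum (λ u → sum λ v → 𝟙 (u Fin.<? v ×-dec E? u v))
        ≡⟨ handshake E? (λ (a , u∈ , v∈) → adj-sym G a , v∈ , u∈) (irrefl G ∘ proj₁) ⟩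
      sum (λ u → sum (E u))                       ∎
      where
      open ≡-Reasoning
      edge? : (p : Fin N × Fin N) → Dec (proj₁ p Fin.< proj₂ p × Adj G (proj₁ p) (proj₂ p))
      edge? (u , v) = u Fin.<? v ×-dec adj? G u v
      within? : (p : Fin N × Fin N) → Dec (proj₁ p ∈ Vₖ × proj₂ p ∈ Vₖ)
      within? (u , v) = u ∈? Vₖ ×-dec v ∈? Vₖ
      E? : ∀ u v → Dec (Adj G u v × u ∈ Vₖ × v ∈ Vₖ)
      E? u v = adj? G u v ×-dec u ∈? Vₖ ×-dec v ∈? Vₖ

    degree-sum-Vₖ : sum (λ u → sum λ v → inVₖ u * 𝟙 (adj? G u v)) ≡ k * ∣ Vₖ ∣
    degree-sum-Vₖ = trans (sum-cong row) (trans (sum-*ˡ k inVₖ) (cong (k *_) (sym (∣∣≡sum Vₖ))))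
      where
      row : ∀ u → sum (λ v → inVₖ u * 𝟙 (adj? G u v)) ≡ k * inVₖ u
      row u = trans (sum-*ˡ (inVₖ u) _) (trans (cong (inVₖ u *_) (sym (degree≡sum u))) cell)
        where
        cell : inVₖ u * degree G u ≡ k * inVₖ u
        cell with u ∈? Vₖ
        ... | yes u∈ = trans (cong (1 *_) (proj₂ (∈Vₖ⁻ u∈))) (*-comm 1 k)
        ... | no _   = sym (*-zeroʳ k)

    -- An edge outside F is counted on the right once for each end in `Vₖ`, so exactly the edges of
    -- Eₖ are counted twice.
    edge-count : size G + ∣Eₖ∣ ≡ size F + k * ∣ Vₖ ∣
    edge-count = *-cancelˡ-≡ _ _ 2 (begin
      2 * (size G + ∣Eₖ∣)                         ≡⟨ *-distribˡ-+ 2 (size G) _ ⟩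
      2 * size G + 2 * ∣Eₖ∣                       ≡⟨ cong₂ _+_ (2*size G) 2*∣Eₖ∣ ⟩
      adjacencies G + sum (λ u → sum (E u))       ≡⟨ sum-sum-+ _ _ ⟨
      sum (λ u → sum λ v → 𝟙 (adj? G u v) + E u v) ≡⟨ sum-cong (λ u → sum-cong (cell u)) ⟩
      sum (λ u → sum λ v → 𝟙 (adj? F u v) + (inVₖ u * 𝟙 (adj? G u v) + inVₖ v * 𝟙 (adj? G u v)))
        ≡⟨ trans (sum-sum-+ _ _) (cong (adjacencies F +_) (sum-sum-+ _ _)) ⟩
      adjacencies F + (sum (λ u → sum λ v → inVₖ u * 𝟙 (adj? G u v)) + sum (λ u → sum λ v → inVₖ v * 𝟙 (adj? G u v)))
        ≡⟨ cong₂ _+_ (sym (2*size F)) (cong₂ _+_ degree-sum-Vₖ columns) ⟩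
      2 * size F + (k * ∣ Vₖ ∣ + k * ∣ Vₖ ∣)      ≡⟨ solve 2 (λ a b → con 2 :* a :+ (b :+ b) := con 2 :* (a :+ b)) refl (size F) (k * ∣ Vₖ ∣) ⟩
      2 * (size F + k * ∣ Vₖ ∣)                   ∎)
      where
      open ≡-Reasoning
      open +-*-Solver
      columns : sum (λ u → sum λ v → inVₖ v * 𝟙 (adj? G u v)) ≡ k * ∣ Vₖ ∣
      columns = trans (sum-comm _) (trans
        (sum-cong λ v → sum-cong λ u → cong (inVₖ v *_) (𝟙-cong (adj? G u v) (adj? G v u) (adj-sym G) (adj-sym G)))
        degree-sum-Vₖ)
      cell : ∀ u v → 𝟙 (adj? G u v) + E u v ≡ 𝟙 (adj? F u v) + (inVₖ u * 𝟙 (adj? G u v) + inVₖ v * 𝟙 (adj? G u v))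
      cell u v with adj? G u v | u ∈? Vₖ | v ∈? Vₖ
      ... | yes _ | yes _ | yes _ = refl
      ... | yes _ | yes _ | no _  = refl
      ... | yes _ | no _  | yes _ = refl
      ... | yes _ | no _  | no _  = refl
      ... | no _  | yes _ | yes _ = refl
      ... | no _  | yes _ | no _  = refl
      ... | no _  | no _  | yes _ = refl
      ... | no _  | no _  | no _  = refl

    order-F : order F + ∣ Vₖ ∣ ≡ order G
    order-F = begin
      order F + ∣ Vₖ ∣                              ≡⟨ cong₂ _+_ (∣∣≡sum (V F)) (∣∣≡sum Vₖ) ⟩
      sum (λ v → 𝟙 (v ∈? V F)) + sum inVₖ           ≡⟨ sum-+ _ _ ⟨
      sum (λ v → 𝟙 (v ∈? V F) + inVₖ v)             ≡⟨ sum-cong cell ⟩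
      sum (λ v → 𝟙 (v ∈? V G))                      ≡⟨ ∣∣≡sum (V G) ⟨
      order G                                       ∎
      where
      open ≡-Reasoning
      cell : ∀ v → 𝟙 (v ∈? V F) + inVₖ v ≡ 𝟙 (v ∈? V G)
      cell v with v ∈? Vₖ
      ... | yes v∈ = trans (cong (_+ 1) (𝟙-no (v ∈? V F) λ v∈F → x∈p─q⇒x∉q (V G) Vₖ v∈F v∈))
                           (sym (𝟙-yes (v ∈? V G) (proj₁ (∈Vₖ⁻ v∈))))
      ... | no v∉  = trans (+-identityʳ _) (𝟙-cong (v ∈? V F) (v ∈? V G) (p─q⊆p (V G) Vₖ) (λ v∈ → x∈p∧x∉q⇒x∈p─q v∈ v∉))

    -- The formula with subtraction and division cleared: `edge-count` combined with the forest
    -- equation for F.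
    count : size G + ∣Eₖ∣ + c-F ≡ order G + κ * ∣ Vₖ ∣
    count = begin
      size G + ∣Eₖ∣ + c-F                ≡⟨ cong (_+ c-F) edge-count ⟩
      size F + k * ∣ Vₖ ∣ + c-F          ≡⟨ solve 4 (λ s κ v c → s :+ (con 1 :+ κ) :* v :+ c := c :+ s :+ v :+ κ :* v) refl (size F) κ ∣ Vₖ ∣ c-F ⟩
      c-F + size F + ∣ Vₖ ∣ + κ * ∣ Vₖ ∣ ≡⟨ cong (λ x → x + ∣ Vₖ ∣ + κ * ∣ Vₖ ∣) (forest-count {g = proj₁ F-descending} F (proj₂ F-descending)) ⟩
      order F + ∣ Vₖ ∣ + κ * ∣ Vₖ ∣      ≡⟨ cong (_+ κ * ∣ Vₖ ∣) order-F ⟩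
      order G + κ * ∣ Vₖ ∣               ∎
      where
      open ≡-Reasoning
      open +-*-Solver

    -- The lower bound for c_F + |Eₖ|

    reachable⇒path : ∀ {u v} → Reachable F u v → Star HighEdge u v
    reachable⇒path = Star.map F⇒highEdge

    private
      E-sym : ∀ u v → E u v ≡ E v u
      E-sym u v = 𝟙-cong (adj? G u v ×-dec u ∈? Vₖ ×-dec v ∈? Vₖ) (adj? G v u ×-dec v ∈? Vₖ ×-dec u ∈? Vₖ)
        (λ (a , u∈ , v∈) → adj-sym G a , v∈ , u∈) (λ (a , v∈ , u∈) → adj-sym G a , u∈ , v∈)

      E≤1 : ∀ u v → E u v ≤ 1
      E≤1 u v = 𝟙≤1 (adj? G u v ×-dec u ∈? Vₖ ×-dec v ∈? Vₖ)

      E-diag : ∀ v → E v v ≡ 0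
      E-diag v = 𝟙-no (adj? G v v ×-dec v ∈? Vₖ ×-dec v ∈? Vₖ) (irrefl G ∘ proj₁)

    sum-E≤∣Eₖ∣ : ∀ q → sum (E q) ≤ ∣Eₖ∣
    sum-E≤∣Eₖ∣ q = *-cancelˡ-≤ 2 (≤-trans (one-row q) (≤-reflexive (sym 2*∣Eₖ∣)))
      where open SymmetricMatrix E E-sym E≤1 E-diag

    degree-split : ∀ {q} → q ∈ Vₖ → k ≡ sum (E q) + sum (λ v → 𝟙 (adj? G q v ×-dec ¬? (v ∈? Vₖ)))
    degree-split {q} q∈ = trans (sym (proj₂ (∈Vₖ⁻ q∈))) (trans (degree≡sum q) (trans (sum-cong cell) (sum-+ _ _)))
      where
      cell : ∀ v → 𝟙 (adj? G q v) ≡ E q v + 𝟙 (adj? G q v ×-dec ¬? (v ∈? Vₖ))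
      cell v with q ∈? Vₖ | adj? G q v | v ∈? Vₖ
      ... | no q∉ | _     | _     = ⊥-elim (q∉ q∈)
      ... | yes _ | yes _ | yes _ = refl
      ... | yes _ | yes _ | no _  = refl
      ... | yes _ | no _  | _     = refl

    Apart : Fin N → Set
    Apart q = ∀ {u v} → Adj G q u → u ∉ Vₖ → Adj G q v → v ∉ Vₖ → Reachable F u v → u ≡ v

    -- Of the k neighbours of `q`, those in `Vₖ` give edges of Eₖ, and the others lie in different
    -- components of F.
    apart⇒bound : ∀ {q} → q ∈ Vₖ → Apart q → k ≤ c-F + ∣Eₖ∣
    apart⇒bound {q} q∈ apart = begin
      k                                                       ≡⟨ degree-split q∈ ⟩
      sum (E q) + sum (λ v → 𝟙 (adj? G q v ×-dec ¬? (v ∈? Vₖ))) ≤⟨ +-mono-≤ (sum-E≤∣Eₖ∣ q)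
        (Components.independent⇒≤ F (λ v → adj? G q v ×-dec ¬? (v ∈? Vₖ))
          (λ (qv , v∉) → x∈p∧x∉q⇒x∈p─q (adj⇒∈Vʳ qv) v∉) (λ (qu , u∉) (qv , v∉) → apart qu u∉ qv v∉)) ⟩
      ∣Eₖ∣ + c-F                                              ≡⟨ +-comm ∣Eₖ∣ c-F ⟩
      c-F + ∣Eₖ∣                                              ∎
      where open ≤-Reasoning

    -- Any vertex of `Vₖ` is trivially apart. If `Vₖ` is empty, F is all of G, which has edges.
    edgeless⇒bound : (∀ {u v} → ¬ Adj F u v) → k ≤ c-F + ∣Eₖ∣
    edgeless⇒bound no-edge with Fin.any? (_∈? Vₖ)
    ... | yes (q , q∈) = apart⇒bound q∈ λ { _ _ _ _ ε → refl ; _ _ _ _ (e ◅ _) → ⊥-elim (no-edge e) }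
    ... | no Vₖ-empty with Fin.any? (_∈? V G)
    ...   | no V-empty = ⊥-elim (<⇒≱ (proj₁ (proj₁ mkc)) (≤-trans
      (≤-reflexive (trans (∣∣≡sum (V G)) (sum-zero λ v → 𝟙-no (v ∈? V G) λ v∈ → V-empty (v , v∈)))) z≤n))
    ...   | yes (v , v∈) with Fin.any? (adj? G v)
    ...     | yes (w , vw) = ⊥-elim (no-edge (vw , (λ v∈ → Vₖ-empty (_ , v∈)) , (λ w∈ → Vₖ-empty (_ , w∈))))
    ...     | no isolated = ⊥-elim (<⇒≱ (k≤degree v∈) (≤-trans
      (≤-reflexive (trans (degree≡sum v) (sum-zero λ w → 𝟙-no (adj? G v w) λ vw → isolated (w , vw)))) z≤n))

    module LowerBound {z y τ} (zy : HighEdge z y) (t : Sep z y τ)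
      (minimal : ∀ {a b σ} → HighEdge a b → Sep a b σ → # L τ ≤ # L σ) where
      open Smallest zy t minimal

      -- Here D and T are the parts that τ labels `L` and `M`, and Q is the intersection of D with
      -- `Vₖ`; `#T` counts only the vertices of T in `Vₖ`.
      d #Q #T #D∪T∖Vₖ : ℕ
      d  = # L τ
      #Q = ∑ᵥ λ v → inVₖ v * ⟦ τ v ∶ L ⟧
      #T = ∑ᵥ λ v → inVₖ v * ⟦ τ v ∶ M ⟧
      #D∪T∖Vₖ = ∑ᵥ λ v → 𝟙 (¬? (v ∈? Vₖ)) * (⟦ τ v ∶ L ⟧ + ⟦ τ v ∶ M ⟧)

      -- The vertex `z` has more than k neighbours. All but `y` are in `Vₖ` by `leaf`, and none of
      -- these is in C.
      k≤#Q+#T : k ≤ #Q + #T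
      k≤#Q+#T = ≤-pred (begin
        suc k                      ≤⟨ proj₂ (proj₁ (proj₂ zy)) ⟩
        degree G z                 ≤⟨ degree-≤ z cell ⟩
        ∑ᵥ (λ v → 𝟙 (v Fin.≟ y) + (inVₖ v * ⟦ τ v ∶ L ⟧ + inVₖ v * ⟦ τ v ∶ M ⟧)) ≡⟨ trans (∑ᵥ-+ _ _) (cong (∑ᵥ (λ v → 𝟙 (v Fin.≟ y)) +_) (∑ᵥ-+ _ _)) ⟩
        ∑ᵥ (λ v → 𝟙 (v Fin.≟ y)) + (#Q + #T) ≤⟨ +-monoˡ-≤ _ (∑ᵥ-δ≤1 y) ⟩
        suc (#Q + #T)              ∎)
        where
        open ≤-Reasoning
        cell : ∀ v → Adj G z v → 1 ≤ 𝟙 (v Fin.≟ y) + (inVₖ v * ⟦ τ v ∶ L ⟧ + inVₖ v * ⟦ τ v ∶ M ⟧)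
        cell v zv with v Fin.≟ y | v ∈? Vₖ | τ v in τv
        ... | yes _  | _     | _ = s≤s z≤n
        ... | no _   | yes _ | L = s≤s z≤n
        ... | no _   | yes _ | M = s≤s z≤n
        ... | no v≢y | yes _ | R = ⊥-elim (v≢y (proj₂ (only t zv (left t) τv)))
        ... | no v≢y | no v∉ | _ = ⊥-elim (v≢y (leaf (zv , proj₁ (proj₂ zy) , high (adj⇒∈Vʳ zv) v∉)))

      module _ {q} (q∈ : q ∈ Vₖ) (τq : τ q ≡ L) where

        q≢z : q ≢ z
        q≢z refl = ¬high q∈ (proj₁ (proj₂ zy))

        neighbour≢R : ∀ {v} → Adj G q v → τ v ≢ R
        neighbour≢R qv τv = q≢z (proj₁ (only t qv τq τv))

        -- All neighbours of `q` lie in D or T. At least k vertices of D and T are in `Vₖ`, so at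
        -- most d + κ - k = d - 1 of these neighbours are high.
        k<sum-E+d : k < sum (E q) + d
        k<sum-E+d = +-cancelʳ-< κ k (sum (E q) + d) (begin-strict
          k + κ                              <⟨ +-monoʳ-< k (n<1+n κ) ⟩
          k + k                              ≤⟨ +-monoʳ-≤ k k≤#Q+#T ⟩
          k + (#Q + #T)                      ≡⟨ cong (_+ (#Q + #T)) (degree-split q∈) ⟩
          sum (E q) + sum (λ v → 𝟙 (adj? G q v ×-dec ¬? (v ∈? Vₖ))) + (#Q + #T)
            ≤⟨ +-monoˡ-≤ (#Q + #T) (+-monoʳ-≤ (sum (E q)) (sum-mono high-neighbour)) ⟩
          sum (E q) + #D∪T∖Vₖ + (#Q + #T)    ≡⟨ +-assoc (sum (E q)) _ _ ⟩
          sum (E q) + (#D∪T∖Vₖ + (#Q + #T))  ≤⟨ +-monoʳ-≤ (sum (E q)) parts ⟩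
          sum (E q) + (d + ∣ τ ∣ᴹ)            ≤⟨ +-monoʳ-≤ (sum (E q)) (+-monoʳ-≤ d (thin t)) ⟩
          sum (E q) + (d + κ)                ≡⟨ +-assoc (sum (E q)) d κ ⟨
          sum (E q) + d + κ                  ∎)
          where
          open ≤-Reasoning
          high-neighbour : ∀ v → 𝟙 (adj? G q v ×-dec ¬? (v ∈? Vₖ)) ≤
                           𝟙 (v ∈? V G) * (𝟙 (¬? (v ∈? Vₖ)) * (⟦ τ v ∶ L ⟧ + ⟦ τ v ∶ M ⟧))
          high-neighbour v with adj? G q v | v ∈? Vₖ | τ v in τv
          ... | no _   | _     | _ = z≤n
          ... | yes _  | yes _ | _ = z≤n
          ... | yes qv | no _  | L rewrite 𝟙-yes (v ∈? V G) (adj⇒∈Vʳ qv) = ≤-refl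
          ... | yes qv | no _  | M rewrite 𝟙-yes (v ∈? V G) (adj⇒∈Vʳ qv) = ≤-refl
          ... | yes qv | no _  | R = ⊥-elim (neighbour≢R qv τv)
          parts : #D∪T∖Vₖ + (#Q + #T) ≤ d + ∣ τ ∣ᴹ
          parts = subst₂ _≤_ (trans (∑ᵥ-+ _ _) (cong (#D∪T∖Vₖ +_) (∑ᵥ-+ _ _))) (∑ᵥ-+ _ _) (∑ᵥ-mono cell)
            where
            cell : ∀ v → v ∈ V G →
              𝟙 (¬? (v ∈? Vₖ)) * (⟦ τ v ∶ L ⟧ + ⟦ τ v ∶ M ⟧) + (inVₖ v * ⟦ τ v ∶ L ⟧ + inVₖ v * ⟦ τ v ∶ M ⟧)
              ≤ ⟦ τ v ∶ L ⟧ + ⟦ τ v ∶ M ⟧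
            cell v _ with v ∈? Vₖ
            ... | yes _ = ≤-reflexive (cong₂ _+_ (+-identityʳ ⟦ τ v ∶ L ⟧) (+-identityʳ ⟦ τ v ∶ M ⟧))
            ... | no _  = ≤-reflexive (trans (+-identityʳ _) (+-identityʳ _))

        big⇒apart : κ < d + d → Apart q
        big⇒apart big qu _ qv _ r = neighbours-apart qu qv (reachable⇒path r)
          where
          q∈V = proj₁ (∈Vₖ⁻ q∈)
          misses-q : ∀ {a b} → HighEdge a b → ∃[ ρ ] Sep a b ρ × ρ q ≢ M
          misses-q e with ρ , s , misses-D ← avoidable big e = ρ , s , misses-D q∈V τq
          open Orientation q∈V (¬high q∈) misses-q

        -- By `end-inside`, a nontrivial walk in F from a vertex of D starts at `z`. Read in both
        -- directions, the walk leaves only equal ends.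
        lonely⇒apart : (∀ {v} → v ∈ Vₖ → τ v ≡ L → v ≡ q) → Apart q
        lonely⇒apart lonely {u} {v} qu u∉ qv v∉ r with step-from (on-L qu u∉) r | step-from (on-L qv v∉) (Components.reachable-sym F r)
          where
          on-L : ∀ {v} → Adj G q v → v ∉ Vₖ → τ v ≡ L
          on-L {v} qv v∉ with τ v in τv
          ... | L = refl
          ... | R = ⊥-elim (neighbour≢R qv τv)
          -- With at most one vertex of `Vₖ` in D, the bound `k≤#Q+#T` needs κ vertices of `Vₖ` in
          -- T, which leaves no room for a high one.
          ... | M = ⊥-elim (<⇒≱ few k≤#Q+#T)
            where
            few : #Q + #T < k
            few = ≤-<-trans (+-monoˡ-≤ #T #Q≤1) (s≤s (<-≤-trans #T<∣τ∣ (thin t)))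
              where
              #Q≤1 : #Q ≤ 1
              #Q≤1 = ≤-trans (∑ᵥ-mono cell) (∑ᵥ-δ≤1 q)
                where
                cell : ∀ v → v ∈ V G → inVₖ v * ⟦ τ v ∶ L ⟧ ≤ 𝟙 (v Fin.≟ q)
                cell v _ with v ∈? Vₖ | τ v in τv
                ... | no _   | _ = z≤n
                ... | yes _  | M = z≤n
                ... | yes _  | R = z≤n
                ... | yes v∈ | L = ≤-reflexive (sym (𝟙-yes (v Fin.≟ q) (lonely v∈ τv)))
              #T<∣τ∣ : #T < ∣ τ ∣ᴹ
              #T<∣τ∣ = ∑ᵥ-mono-< (λ v _ → ≤-trans (*-monoˡ-≤ ⟦ τ v ∶ M ⟧ (𝟙≤1 (v ∈? Vₖ))) (≤-reflexive (*-identityˡ _)))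
                (adj⇒∈Vʳ qv) strict
                where
                strict : inVₖ v * ⟦ τ v ∶ M ⟧ < ⟦ τ v ∶ M ⟧
                strict rewrite 𝟙-no (v ∈? Vₖ) v∉ | τv = s≤s z≤n
          step-from : ∀ {u v} → τ u ≡ L → Reachable F u v → u ≡ v ⊎ u ≡ z
          step-from τu ε       = inj₁ refl
          step-from τu (e ◅ _) = inj₂ (end-inside (F⇒highEdge e) τu)
        ... | inj₁ u≡v | _        = u≡v
        ... | inj₂ _   | inj₁ v≡u = sym v≡u
        ... | inj₂ u≡z | inj₂ v≡z = trans u≡z (sym v≡z)

      -- Each of `p` and `q` has more than k - d neighbours in `Vₖ`, and only the edge `pq` can be
      -- counted twice.
      two⇒bound : ∀ {p q} → p ∈ Vₖ → τ p ≡ L → q ∈ Vₖ → τ q ≡ L → p ≢ q → d + d ≤ κ → k ≤ c-F + ∣Eₖ∣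
      two⇒bound {p} {q} p∈ τp q∈ τq p≢q small = ≤-trans (+-cancelʳ-≤ (suc κ) k ∣Eₖ∣ (begin
        k + k                                 ≤⟨ +-cancelʳ-≤ 2 (k + k) _ (begin
          k + k + 2                             ≡⟨ solve 1 (λ k → k :+ k :+ con 2 := (con 1 :+ k) :+ (con 1 :+ k)) refl k ⟩
          suc k + suc k                         ≤⟨ +-mono-≤ (k<sum-E+d p∈ τp) (k<sum-E+d q∈ τq) ⟩
          (sum (E p) + d) + (sum (E q) + d)     ≡⟨ solve 3 (λ a b d → (a :+ d) :+ (b :+ d) := (a :+ b) :+ (d :+ d)) refl (sum (E p)) (sum (E q)) d ⟩
          (sum (E p) + sum (E q)) + (d + d)     ≤⟨ +-mono-≤ rows small ⟩
          ∣Eₖ∣ + 1 + κ                           ≤⟨ m≤m+n _ 2 ⟩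
          ∣Eₖ∣ + 1 + κ + 2                       ≡⟨ cong (_+ 2) (+-assoc ∣Eₖ∣ 1 κ) ⟩
          ∣Eₖ∣ + suc κ + 2                       ∎) ⟩
        ∣Eₖ∣ + suc κ                           ∎)) (m≤n+m ∣Eₖ∣ c-F)
        where
        open ≤-Reasoning
        open +-*-Solver
        open SymmetricMatrix E E-sym E≤1 E-diag
        rows : sum (E p) + sum (E q) ≤ ∣Eₖ∣ + 1
        rows = *-cancelˡ-≤ 2 (≤-trans (two-rows p≢q) (≤-reflexive
          (trans (cong (_+ 2) (sym 2*∣Eₖ∣)) (sym (*-distribˡ-+ 2 ∣Eₖ∣ 1)))))

      bound : k ≤ c-F + ∣Eₖ∣
      bound with Fin.any? (λ q → q ∈? Vₖ ×-dec τ q Fin.≟ L)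
      -- If D missed `Vₖ`, the k vertices of `k≤#Q+#T` would all lie in T, which has at most κ.
      ... | no none = ⊥-elim (<⇒≱ (s≤s few) k≤#Q+#T)
        where
        few : #Q + #T ≤ κ
        few = subst (_≤ κ) (∑ᵥ-+ _ _) (≤-trans (∑ᵥ-mono cell) (thin t))
          where
          cell : ∀ v → v ∈ V G → inVₖ v * ⟦ τ v ∶ L ⟧ + inVₖ v * ⟦ τ v ∶ M ⟧ ≤ ⟦ τ v ∶ M ⟧
          cell v _ with v ∈? Vₖ | τ v in τv
          ... | no _   | _ = z≤n
          ... | yes _  | M = ≤-refl
          ... | yes _  | R = z≤n
          ... | yes v∈ | L = ⊥-elim (none (v , v∈ , τv))
      ... | yes (q , q∈ , τq) with κ <? d + d | Fin.any? (λ p → p ∈? Vₖ ×-dec τ p Fin.≟ L ×-dec ¬? (p Fin.≟ q))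
      ...   | yes big  | _ = apart⇒bound q∈ (big⇒apart q∈ τq big)
      ...   | no small | yes (p , p∈ , τp , p≢q) = two⇒bound p∈ τp q∈ τq p≢q (≮⇒≥ small)
      ...   | no _     | no none = apart⇒bound q∈ (lonely⇒apart q∈ τq λ {v} v∈ τv →
        decidable-stable (v Fin.≟ q) λ v≢q → none (v , v∈ , τv , v≢q))

    edge⇒bound : ∀ {u v} → Adj F u v → k ≤ c-F + ∣Eₖ∣
    -- Under the negated bound, well-founded descent refutes every smaller separation, so the
    -- current one is minimal and `LowerBound` applies; no search over labellings takes place.
    edge⇒bound uv = decidable-stable (k ≤? c-F + ∣Eₖ∣) λ ¬bound →
      let e = F⇒highEdge uv ; ρ , s = critical (proj₁ e) in descent ¬bound e s (<-wellFounded (# L ρ))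
      where
      descent : ¬ k ≤ c-F + ∣Eₖ∣ → ∀ {z y τ} → HighEdge z y → Sep z y τ → Acc _<_ (# L τ) → ⊥
      descent ¬bound zy t (acc rs) = ¬bound (LowerBound.bound zy t λ e s →
        ≮⇒≥ λ smaller → descent ¬bound e s (rs smaller))

    k≤c-F+∣Eₖ∣ : k ≤ c-F + ∣Eₖ∣
    k≤c-F+∣Eₖ∣ with Fin.any? (λ u → Fin.any? (adj? F u))
    ... | yes (u , v , uv) = edge⇒bound uv
    ... | no none = edgeless⇒bound λ uv → none (_ , _ , uv)

open GraphTheory using (module Counting)
open import Data.Nat using (_∸_; NonZero; >-nonZero)
open import Data.Nat.Properties using (m<n⇒0<n∸m)
import Data.Nat as ℕ
import Data.Nat.Properties as ℕ
open import Data.Integer using (ℤ; +_; _+_; _-_; _*_; -_; _<_) renaming (_≤_ to _≤ℤ_)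
import Data.Integer as ℤ
import Data.Integer.Properties as ℤ
import Data.Integer.DivMod as ℤ
open import Data.Integer.Tactic.RingSolver using (solve-∀)
open import Data.Rational using (ℚ; _/_; ceiling; floor; toℚᵘ; ↥_; ↧_)
import Data.Rational as ℚ
import Data.Rational.Properties as ℚ
open import Data.Rational.Unnormalised using (mkℚᵘ; *≤*; *≡*) renaming (_≤_ to _≤ᵘ_)
import Data.Rational.Unnormalised.Properties as ℚᵘ

-- Fractions and ceilings

fraction-≡ : ∀ v j i → i ≡ + (suc j ℕ.* v) → + v / 1 ≡ i / suc j
fraction-≡ v j i refl = ℚ.fromℚᵘ-cong {mkℚᵘ (+ v) 0} {mkℚᵘ i j} (*≡* (begin
  + v * + suc j           ≡⟨ ℤ.pos-* v (suc j) ⟨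
  + (v ℕ.* suc j)         ≡⟨ cong +_ (ℕ.*-comm v (suc j)) ⟩
  + (suc j ℕ.* v)         ≡⟨ ℤ.*-identityʳ _ ⟨
  + (suc j ℕ.* v) * + 1   ∎))
  where open ≡-Reasoning

-- Division with remainder puts the numerator strictly below `suc (floor p)` times the denominator.
floor-≥ : ∀ (p : ℚ) w → w * ↧ p ≤ℤ ↥ p → w ≤ℤ floor p
floor-≥ p@record{ denominator-1 = d } w w≤p =
  subst₂ _≤ℤ_ (ℤ.pred-suc w) (ℤ.pred-suc (floor p)) (ℤ.pred-mono (ℤ.i<j⇒suc[i]≤j w<suc))
  where
  w<suc : w < ℤ.suc (floor p)
  w<suc = ℤ.*-cancelʳ-<-nonNeg (+ suc d) (ℤ.≤-<-trans w≤p
    (subst (λ q → ↥ p < ℤ.suc q * + suc d) (sym (ℤ.div-pos-is-/ℕ (↥ p) (suc d))) (ℤ.n<s[n/ℕd]*d (↥ p) (suc d))))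

-- The ceiling is the negated floor of `- p`, so negating both sides reduces the claim to `floor-≥`.
ceiling-≤ : ∀ (p : ℚ) v → toℚᵘ p ≤ᵘ mkℚᵘ v 0 → ceiling p ≤ℤ v
ceiling-≤ p@record{} v (*≤* p≤v) = subst (ceiling p ≤ℤ_) (ℤ.neg-involutive v) (ℤ.neg-mono-≤
  (floor-≥ (ℚ.- p) (- v) (subst₂ _≤ℤ_
    (trans (ℤ.neg-distribˡ-* v (↧ p)) (cong (- v *_) (sym (ℚ.↧-neg p))))
    (trans (cong -_ (ℤ.*-identityʳ (↥ p))) (sym (ℚ.↥-neg p)))
    (ℤ.neg-mono-≤ p≤v))))

ceiling-fraction-≤ : ∀ v j i → i ≤ℤ + (suc j ℕ.* v) → ceiling (i / suc j) ≤ℤ + v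
ceiling-fraction-≤ v j i i≤ = ceiling-≤ (i / suc j) (+ v) (ℚᵘ.≤-respˡ-≃
  (ℚᵘ.≃-sym {toℚᵘ (i / suc j)} {mkℚᵘ i j} (ℚ.toℚᵘ-fromℚᵘ (mkℚᵘ i j)))
  (*≤* {mkℚᵘ i j} {mkℚᵘ (+ v) 0} (subst₂ _≤ℤ_ (sym (ℤ.*-identityʳ i))
    (trans (cong +_ (ℕ.*-comm (suc j) v)) (ℤ.pos-* v (suc j))) i≤)))

ℤ-count : ∀ m n c e w → m ℕ.+ e ℕ.+ c ≡ n ℕ.+ w → + m - + n + + c + + e ≡ + w
ℤ-count m n c e w eq = begin
  + m - + n + + c + + e           ≡⟨ rearrange (+ m) (+ n) (+ c) (+ e) ⟩
  + m + + e + + c - + n           ≡⟨ cong (λ x → x - + n) (cong (_+ + c) (ℤ.pos-+ m e)) ⟨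
  + (m ℕ.+ e) + + c - + n         ≡⟨ cong (λ x → x - + n) (ℤ.pos-+ (m ℕ.+ e) c) ⟨
  + (m ℕ.+ e ℕ.+ c) - + n         ≡⟨ cong (λ x → + x - + n) eq ⟩
  + (n ℕ.+ w) - + n               ≡⟨ cong (λ x → x - + n) (ℤ.pos-+ n w) ⟩
  + n + + w - + n                 ≡⟨ cancel (+ n) (+ w) ⟩
  + w                             ∎
  where
  open ≡-Reasoning
  rearrange : ∀ (m n c e : ℤ) → m - n + c + e ≡ m + e + c - n
  rearrange = solve-∀
  cancel : ∀ (n w : ℤ) → n + w - n ≡ w
  cancel = solve-∀

mainTheorem2 :
  ∀ {N : ℕ} (k : ℕ) (2≤k : 2 ≤ k) (G : Graph N) → MinimallyKConnected k G →
  let n   = order G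
      m   = size G
      Vₖ  = verticesOfDegree k G
      Eₖ  = edgesWithin G Vₖ
      F   = deleteVertices G Vₖ
      c-F = componentCount F
      instance
        k-1≢0 : NonZero (k ∸ 1)
        k-1≢0 = >-nonZero (m<n⇒0<n∸m 2≤k)
  in
    (+ ∣ Vₖ ∣) / 1 ≡ (+ m - + n + + c-F + + length Eₖ) / (k ∸ 1)
    ×
    ceiling ((+ m - + n + + k) / (k ∸ 1)) ≤ℤ + ∣ Vₖ ∣
-- Splitting k twice lets `k ∸ 1` compute to `suc j`, which is the κ passed to `Counting`.
mainTheorem2 (suc (suc j)) 2≤k@(s≤s (s≤s z≤n)) G mkc =
  (fraction-≡ ∣ Vₖ ∣ j _ numerator) , (ceiling-fraction-≤ ∣ Vₖ ∣ j _ (begin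
    + m - + n + + k                      ≤⟨ ℤ.+-monoʳ-≤ (+ m - + n) (ℤ.+≤+ k≤c-F+∣Eₖ∣) ⟩
    + m - + n + + (c-F ℕ.+ ∣Eₖ∣)          ≡⟨ cong (λ x → + m - + n + x) (ℤ.pos-+ c-F ∣Eₖ∣) ⟩
    + m - + n + (+ c-F + + ∣Eₖ∣)          ≡⟨ ℤ.+-assoc (+ m - + n) (+ c-F) (+ ∣Eₖ∣) ⟨
    + m - + n + + c-F + + ∣Eₖ∣            ≡⟨ numerator ⟩
    + (suc j ℕ.* ∣ Vₖ ∣)                  ∎))
  where
  open Counting G (suc j) mkc
  open ℤ.≤-Reasoning
  m = size G
  n = order G
  numerator : + m - + n + + c-F + + ∣Eₖ∣ ≡ + (suc j ℕ.* ∣ Vₖ ∣)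
  numerator = ℤ-count m n c-F ∣Eₖ∣ (suc j ℕ.* ∣ Vₖ ∣) count
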